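{- Let $k\ge 2$. For every $n\ge 1$, the number $\mathrm{DBW}_k(kn)$ of generalized de Bruijn words of length $kn$ over $\Sigma_k$ equals \[\mathrm{DBW}_k(kn)=((k-1)!)^n\,\kappa(\mathrm{DB}(k,n)).\]
   Context: $\Sigma_k=\{0,1,\ldots,k-1\}$ with its natural order. A necklace is the set of rotations (conjugacy class) of a word. The Burrows–Wheeler matrix of a necklace $[w]$ of length $N$ is the $N\times N$ matrix whose rows are the $N$ rotations of $w$ (with multiplicity) in ascending lexicographic order; $\mathrm{BWT}([w])$ is its last column read top to bottom. A generalized de Bruijn word is a necklace of length $kn$ over $\Sigma_k$ whose BWT is a concatenation of words each of which contains every letter of $\Sigma_k$ exactly once. The generalized de Bruijn graph $\mathrm{DB}(k,n)$ is the directed multigraph with vertex set $\{0,\ldots,n-1\}$ having, for each vertex $m$ and each $i\in\{0,\ldots,k-1\}$, an edge $m\to km+i\bmod n$ (loops and multiple edges allowed). For an Eulerian directed graph $G$, $\kappa(G)$ denotes the number of oriented spanning trees of $G$ directed toward a fixed root vertex (every non-root vertex has outdegree $1$, the root outdegree $0$, no directed cycles); for Eulerian graphs this does not depend on the root and equals the determinant of the Laplacian $D_G-A_G$ with the last row and column removed. -}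

module Defs where

open import Data.Bool using (Bool; true; false; if_then_else_; _∧_)
open import Data.Nat using (ℕ; zero; suc; _+_; _*_; _<ᵇ_; _≡ᵇ_)
open import Data.Nat.DivMod using (_mod_)
open import Data.Fin using (Fin; toℕ) renaming (zero to fzero; suc to fsuc)
open import Data.List using (List; []; _∷_; [_]; _++_; length; map; concatMap; mapMaybe; last; filterᵇ; allFin; take; drop; null)
open import Data.Vec using (Vec; lookup; toList) renaming ([] to []ᵛ; _∷_ to _∷ᵛ_)

allᵇ : ∀ {A : Set} → (A → Bool) → List A → Bool
allᵇ p []       = true
allᵇ p (x ∷ xs) = p x ∧ allᵇ p xs

Word : ℕ → Set
Word k = List (Fin k)

allVecs : (k N : ℕ) → List (Vec (Fin k) N)
allVecs k zero    = [ []ᵛ ]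
allVecs k (suc N) = concatMap (λ a → map (a ∷ᵛ_) (allVecs k N)) (allFin k)

allWords : (k N : ℕ) → List (Word k)
allWords k N = map toList (allVecs k N)

lexLeq : ∀ {k} → Word k → Word k → Bool
lexLeq []       _        = true
lexLeq (_ ∷ _)  []       = false
lexLeq (x ∷ xs) (y ∷ ys) =
  if toℕ x <ᵇ toℕ y then true
  else (if toℕ x ≡ᵇ toℕ y then lexLeq xs ys else false)

rot1 : ∀ {A : Set} → List A → List A
rot1 []       = []
rot1 (x ∷ xs) = xs ++ [ x ]

rotationsN : ∀ {A : Set} → ℕ → List A → List (List A)
rotationsN zero    w = []
rotationsN (suc i) w = w ∷ rotationsN i (rot1 w)

rotations : ∀ {A : Set} → List A → List (List A)
rotations w = rotationsN (length w) w

insertLex : ∀ {k} → Word k → List (Word k) → List (Word k)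
insertLex u []       = u ∷ []
insertLex u (v ∷ vs) = if lexLeq u v then u ∷ v ∷ vs else v ∷ insertLex u vs

sortLex : ∀ {k} → List (Word k) → List (Word k)
sortLex []       = []
sortLex (u ∷ us) = insertLex u (sortLex us)

bwMatrix : ∀ {k} → Word k → List (Word k)
bwMatrix w = sortLex (rotations w)

bwt : ∀ {k} → Word k → Word k
bwt w = mapMaybe last (bwMatrix w)

countLetter : ∀ {k} → Fin k → Word k → ℕ
countLetter a []       = 0
countLetter a (x ∷ xs) = (if toℕ a ≡ᵇ toℕ x then 1 else 0) + countLetter a xs

isPermWord : (k : ℕ) → Word k → Bool
isPermWord k u = allᵇ (λ a → countLetter a u ≡ᵇ 1) (allFin k)

-- u is a concatenation of words each containing every letter of Σ_k
-- exactly once (such words have length k, so they are the consecutive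
-- length-k blocks of u); the first argument is fuel (≥ number of blocks)
isPermConcatF : (k : ℕ) → ℕ → Word k → Bool
isPermConcatF k zero    u = null u
isPermConcatF k (suc f) [] = true
isPermConcatF k (suc f) (x ∷ xs) =
  isPermWord k (take k (x ∷ xs)) ∧ isPermConcatF k f (drop k (x ∷ xs))

isPermConcat : (k : ℕ) → Word k → Bool
isPermConcat k u = isPermConcatF k (length u) u

-- the necklace [w] is a generalized de Bruijn word (BWT does not depend
-- on the chosen representative of the necklace)
isGenDeBruijn : (k : ℕ) → Word k → Bool
isGenDeBruijn k w = isPermConcat k (bwt w)

isNecklaceRep : ∀ {k} → Word k → Bool
isNecklaceRep w = allᵇ (lexLeq w) (rotations w)

DBW : (k N : ℕ) → ℕ
DBW k N = length (filterᵇ (λ w → isNecklaceRep w ∧ isGenDeBruijn k w) (allWords k N))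

-- Generalized de Bruijn graph DB(k, n), vertices Fin n,
-- edges m → (k m + i) mod n for i ∈ Fin k (edge labelled (m , i)).
-- Oriented spanning trees towards the root vertex 0: a choice of one
-- outgoing edge (label i) for each non-root vertex, with no directed
-- cycle, i.e. following chosen edges from any vertex reaches the root.

-- vertices of DB(k, suc m): Fin (suc m); non-root vertices: fsuc j, j : Fin m
-- c : the chosen outgoing edge label for each non-root vertex
treeStep : (k m : ℕ) → Vec (Fin k) m → Fin (suc m) → Fin (suc m)
treeStep k m c fzero    = fzero
treeStep k m c (fsuc j) = (k * toℕ (fsuc j) + toℕ (lookup c j)) mod (suc m)

iter : ∀ {A : Set} → ℕ → (A → A) → A → A
iter zero    f x = x
iter (suc i) f x = f (iter i f x)

-- the chosen edges contain no directed cycle: every vertex reaches the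
-- root (there are suc m vertices, so suc m steps suffice)
isOrientedTree : (k m : ℕ) → Vec (Fin k) m → Bool
isOrientedTree k m c =
  allᵇ (λ v → toℕ (iter (suc m) (treeStep k m c) v) ≡ᵇ 0) (allFin (suc m))

κDB : (k n : ℕ) → ℕ
κDB k zero    = 0
κDB k (suc m) = length (filterᵇ (isOrientedTree k m) (allVecs k m))

{-# OPTIONS --safe #-}
module Submission where

-- Write e = k v + i = n a + w for the edge of DB(k, n) from v to w with label i. A generalized de Bruijn word read
-- cyclically records the letters a along an Eulerian tour starting with the loop 0: its t-th rotation is the row of its
-- Burrows-Wheeler matrix whose index is the t-th edge, and the blocks of the transform say that the successor map on
-- edges is a bijection at each vertex. As in the BEST theorem, a tour amounts to the order in which it leaves each
-- vertex: the last exits from the non-root vertices form an oriented tree, and the remaining k - 1 edges at each vertex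
-- (all but the loop 0 at the root) can be ordered arbitrarily, which gives the factor (k - 1)! for each of the n vertices.
open import Defs
open import Data.Nat using (ℕ; _≤_; _*_; _^_; _∸_; _!)
open import Relation.Binary.PropositionalEquality using (_≡_)
open import Data.Nat using (zero; suc; _+_; _<_; z≤n; s≤s; _≡ᵇ_; _<ᵇ_)
import Data.Nat.Properties as ℕ
open import Data.Nat.DivMod using (_mod_; _%_; [m+kn]%n≡m%n; m<n⇒m%n≡m)
open import Data.Bool using (Bool; true; false; if_then_else_; T; T?; _∧_)
open import Data.Maybe using (Maybe; just)
import Data.Maybe.Properties as Maybe
open import Data.Fin using (Fin; toℕ; punchIn; punchOut; combine; remQuot; quotient; remainder; cast; _↑ˡ_; _↑ʳ_)
  renaming (zero to fzero; suc to fsuc)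
import Data.Fin.Properties as Fin
open import Data.Product using (Σ; ∃₂; ∃-syntax; _×_; _,_; proj₁; proj₂)
open import Data.Sum using (_⊎_; inj₁; inj₂)
open import Data.List using (List; []; _∷_; [_]; _++_; _∷ʳ_; length; map; concatMap; filter; filterᵇ; allFin; tabulate;
  initLast; _∷ʳ′_; take; drop; mapMaybe; last; head)
import Data.List.Properties as List
open import Data.List.Membership.Propositional using (_∈_; _∉_; find; lose)
import Data.List.Membership.Propositional.Properties as ∈
open import Data.List.Relation.Unary.Any using (here; there)
open import Data.List.Relation.Unary.All as All using (All; []; _∷_)
import Data.List.Relation.Unary.All.Properties as All
open import Data.List.Relation.Unary.AllPairs using (AllPairs; []; _∷_)
import Data.List.Relation.Unary.AllPairs.Properties as AllPairs
open import Data.List.Relation.Unary.Unique.Propositional using (Unique)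
import Data.List.Relation.Unary.Unique.Propositional.Properties as Unique
open import Data.List.Relation.Binary.Permutation.Propositional
  using (_↭_; ↭-refl; ↭-sym; ↭-trans; prep; swap; ↭⇒↭ₛ)
import Data.List.Relation.Binary.Permutation.Propositional.Properties as ↭
import Data.List.Relation.Binary.Permutation.Setoid.Properties as ↭ₛ
open import Data.Vec using (Vec; lookup; toList) renaming ([] to []ᵛ; _∷_ to _∷ᵛ_)
import Data.Vec as Vec
import Data.Vec.Properties as Vec
open import Function using (_∘_; id)
open import Relation.Nullary using (yes; no; contradiction; does)
open import Relation.Binary using (tri<; tri≈; tri>)
open import Relation.Binary.PropositionalEquality
  using (refl; sym; trans; cong; cong₂; subst; subst₂; _≢_; setoid; module ≡-Reasoning)

-- The two readings of an edge number turn the lexicographic order of rows into the numerical order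
-- of edges: k v + i sorts by source, n a + w sorts by letter and then by target, and the target is
-- the source of the next edge. A comparison of two rotations of a tour is thus handed on from edge
-- to edge until the letters differ. The converse is harder, because a word comes without edges.
-- They enter as positions in its sorted matrix, and the tour is found by inverting the transform:
-- the rows with their last letter moved to the front, rearranged along `next`, are again sorted,
-- and a sorted list with given entries is unique. Since 0 is the least edge, a tour starting there
-- spells the least rotation, the representative that `isNecklaceRep` selects. This fixes the first
-- exit at the root, just as the tree fixes the last exit elsewhere. The two counts are compared
-- through a one-to-one relation whose middle term is a tour, in place of explicit inverse maps.

private variable
  A B : Set

-- Lists without repetition, and counting by relations

Unique-resp-↭ : {xs ys : List A} → xs ↭ ys → Unique xs → Unique ys
Unique-resp-↭ {A = A} p = ↭ₛ.Unique-resp-↭ (setoid A) (↭⇒↭ₛ p)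

Unique-∷ : {x : A} {xs : List A} → x ∉ xs → Unique xs → Unique (x ∷ xs)
Unique-∷ x∉ u = All.¬Any⇒All¬ _ x∉ ∷ u

Unique-head : {x : A} {xs : List A} → Unique (x ∷ xs) → x ∉ xs
Unique-head (px ∷ _) = All.All¬⇒¬Any px

Unique-++⁻ˡ : (xs : List A) {ys : List A} → Unique (xs ++ ys) → Unique xs
Unique-++⁻ˡ []       _        = []
Unique-++⁻ˡ (x ∷ xs) (px ∷ u) = All.++⁻ˡ xs px ∷ Unique-++⁻ˡ xs u

Unique-++⁻-disjoint : (xs : List A) {ys : List A} {x : A} → Unique (xs ++ ys) → x ∈ xs → x ∉ ys
Unique-++⁻-disjoint (x ∷ xs) u (here refl) x∈ys = Unique-head u (∈.∈-++⁺ʳ xs x∈ys)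
Unique-++⁻-disjoint (x ∷ xs) (_ ∷ u) (there p) x∈ys = Unique-++⁻-disjoint xs u p x∈ys

Unique⇒complement : {xs ys : List A} → Unique xs → (∀ {x} → x ∈ xs → x ∈ ys) →
  ∃[ zs ] ys ↭ xs ++ zs
Unique⇒complement {xs = []} {ys} _ _ = ys , ↭-refl
Unique⇒complement {xs = x ∷ xs} (px ∷ u) xs⊆ys with ∈.∈-∃++ (xs⊆ys (here refl))
... | as , bs , refl with Unique⇒complement u xs⊆rest
  where
  xs⊆rest : ∀ {y} → y ∈ xs → y ∈ as ++ bs
  xs⊆rest y∈xs with ↭.∈-resp-↭ (↭.shift x as bs) (xs⊆ys (there y∈xs))
  ... | here refl = contradiction y∈xs (Unique-head (px ∷ u))
  ... | there p = p
... | zs , p = zs , ↭-trans (↭.shift x as bs) (prep x p)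

Unique⇒length≤ : {xs ys : List A} → Unique xs → (∀ {x} → x ∈ xs → x ∈ ys) → length xs ≤ length ys
Unique⇒length≤ {xs = xs} u s with Unique⇒complement u s
... | zs , p = ℕ.≤-trans (ℕ.≤-trans (ℕ.m≤m+n _ _) (ℕ.≤-reflexive (sym (List.length-++ xs)))) (ℕ.≤-reflexive (sym (↭.↭-length p)))

Unique⇒↭ : {xs ys : List A} → Unique xs → (∀ {x} → x ∈ xs → x ∈ ys) → length ys ≤ length xs → xs ↭ ys
Unique⇒↭ {xs = xs} u s l with Unique⇒complement u s
... | zs , p with zs
... | [] = ↭-sym (subst (_ ↭_) (List.++-identityʳ xs) p)
... | z ∷ zs′ = contradiction
  (subst (_≤ length xs) (trans (↭.↭-length p) (trans (List.length-++ xs) (ℕ.+-suc _ _))) l)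
  (ℕ.<⇒≱ (s≤s (ℕ.m≤m+n _ _)))

Unique⇒↭-allFin : ∀ {n} {xs : List (Fin n)} → Unique xs → (∀ i → i ∈ xs) → xs ↭ allFin n
Unique⇒↭-allFin u s =
  Unique⇒↭ u (λ _ → ∈.∈-allFin _) (Unique⇒length≤ (Unique.allFin⁺ _) (λ _ → s _))

length-allFin : ∀ n → length (allFin n) ≡ n
length-allFin n = List.length-tabulate {n = n} id

covering⇒↭-allFin : ∀ {n} {xs : List (Fin n)} → length xs ≡ n → (∀ i → i ∈ xs) → xs ↭ allFin n
covering⇒↭-allFin {n} l s =
  ↭-sym (Unique⇒↭ (Unique.allFin⁺ _) (λ _ → s _) (ℕ.≤-reflexive (trans l (sym (length-allFin n)))))

long-Unique⇒∈ : ∀ {n} {xs : List (Fin n)} → Unique xs → length xs ≡ n → ∀ i → i ∈ xs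
long-Unique⇒∈ {n} u l i = ↭.∈-resp-↭
  (↭-sym (Unique⇒↭ u (λ _ → ∈.∈-allFin _) (ℕ.≤-reflexive (trans (length-allFin n) (sym l))))) (∈.∈-allFin i)

Unique-length≤ : ∀ {n} {xs : List (Fin n)} → Unique xs → length xs ≤ n
Unique-length≤ {xs = xs} u = subst (length xs ≤_) (length-allFin _) (Unique⇒length≤ u (λ _ → ∈.∈-allFin _))

injective⇒↭ : ∀ {n} {f : Fin n → Fin n} → (∀ {i j} → f i ≡ f j → i ≡ j) → tabulate f ↭ allFin n
injective⇒↭ {n} {f} inj = covering⇒↭-allFin len (long-Unique⇒∈ (Unique.tabulate⁺ inj) len)
  where len = List.length-tabulate f

injective⇒surjective : ∀ {n} {f : Fin n → Fin n} → (∀ {i j} → f i ≡ f j → i ≡ j) → ∀ j → ∃[ i ] f i ≡ j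
injective⇒surjective inj j with ∈.∈-tabulate⁻ (↭.∈-resp-↭ (↭-sym (injective⇒↭ inj)) (∈.∈-allFin j))
... | i , j≡fi = i , sym j≡fi

-- A choice of preimages is injective, hence onto by finiteness. Every element is therefore the
-- chosen preimage of something, and so is determined by its image.
surjective⇒injective : ∀ {n} {f : Fin n → Fin n} → (∀ j → ∃[ i ] f i ≡ j) → ∀ {i j} → f i ≡ f j → i ≡ j
surjective⇒injective {n} {f} surj {i} {j} eq with injective⇒surjective {f = σ} σ-inj i | injective⇒surjective {f = σ} σ-inj j
  where
  σ : Fin n → Fin n
  σ a = proj₁ (surj a)
  σ-inj : ∀ {a b} → σ a ≡ σ b → a ≡ b
  σ-inj {a} {b} e = trans (sym (proj₂ (surj a))) (trans (cong f e) (proj₂ (surj b)))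
... | a , refl | b , refl = cong (λ c → proj₁ (surj c)) (trans (sym (proj₂ (surj a))) (trans eq (proj₂ (surj b))))

-- Partners picked one by one stay distinct, because no `y` is related to two elements. With a
-- relation in place of a map, one correspondence serves for both inequalities of the final count.
length≤-by-relation : {xs : List A} {ys : List B} (R : A → B → Set) → Unique xs →
  (∀ {x} → x ∈ xs → ∃[ y ] y ∈ ys × R x y) →
  (∀ {x x′ y} → R x y → R x′ y → x ≡ x′) → length xs ≤ length ys
length≤-by-relation {A = A} {B = B} {xs} {ys} R uxs total inj =
  let zs , uzs , zs⊆ys , _ , l = image xs uxs total in subst (_≤ length ys) l (Unique⇒length≤ uzs zs⊆ys)
  where
  image : ∀ xs → Unique xs → (∀ {x} → x ∈ xs → ∃[ y ] y ∈ ys × R x y) →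
    ∃[ zs ] Unique zs × (∀ {z} → z ∈ zs → z ∈ ys) × (∀ {z} → z ∈ zs → ∃[ x ] x ∈ xs × R x z) × length zs ≡ length xs
  image [] _ _ = [] , [] , (λ ()) , (λ ()) , refl
  image (x ∷ xs) (px ∷ u) tot with image xs u (tot ∘ there) | tot (here refl)
  ... | zs , uzs , sub , src , l | y , y∈ys , Rxy =
    y ∷ zs , Unique-∷ y∉zs uzs , (λ { (here refl) → y∈ys ; (there p) → sub p }) ,
    (λ { (here refl) → x , here refl , Rxy ; (there p) → let x′ , q , r = src p in x′ , there q , r }) , cong suc l
    where
    y∉zs : y ∉ zs
    y∉zs p with src p
    ... | x′ , x′∈ , Rx′y with inj Rxy Rx′y
    ... | refl = Unique-head (px ∷ u) x′∈

∈-concatMap⁻ : (f : A → List B) (xs : List A) {y : B} → y ∈ concatMap f xs → ∃[ x ] x ∈ xs × y ∈ f x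
∈-concatMap⁻ f xs p = find (∈.∈-concatMap⁻ f p)

∈-concatMap⁺ : (f : A → List B) {xs : List A} {x : A} {y : B} → x ∈ xs → y ∈ f x → y ∈ concatMap f xs
∈-concatMap⁺ f p q = ∈.∈-concatMap⁺ f (lose p q)

Unique-concatMap : {f : A → List B} {xs : List A} → Unique xs → (∀ x → Unique (f x)) →
  (∀ {x x′ y} → y ∈ f x → y ∈ f x′ → x ≡ x′) → Unique (concatMap f xs)
Unique-concatMap {xs = []} _ _ _ = []
Unique-concatMap {f = f} {xs = x ∷ xs} (px ∷ u) uf key =
  Unique.++⁺ (uf x) (Unique-concatMap u uf key) λ (p , q) →
    let x′ , x′∈xs , q′ = ∈-concatMap⁻ f xs q in Unique-head (px ∷ u) (subst (_∈ xs) (sym (key p q′)) x′∈xs)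

length-concatMap : (f : A → List B) (xs : List A) {c : ℕ} → (∀ x → length (f x) ≡ c) →
  length (concatMap f xs) ≡ length xs * c
length-concatMap f [] _ = refl
length-concatMap f (x ∷ xs) l =
  trans (List.length-++ (f x)) (cong₂ _+_ (l x) (length-concatMap f xs l))

-- Cartesian products and permutations

choices : ∀ {n} → Vec (List A) n → List (Vec A n)
choices []ᵛ         = [ []ᵛ ]
choices (xs ∷ᵛ xss) = concatMap (λ x → map (x ∷ᵛ_) (choices xss)) xs

Unique-choices : ∀ {n} (xss : Vec (List A) n) → (∀ i → Unique (lookup xss i)) → Unique (choices xss)
Unique-choices []ᵛ _ = [] ∷ []
Unique-choices (xs ∷ᵛ xss) u =
  Unique-concatMap (u fzero) (λ x → Unique.map⁺ Vec.∷-injectiveʳ (Unique-choices xss (u ∘ fsuc))) key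
  where
  key : ∀ {x x′ y} → y ∈ map (x ∷ᵛ_) (choices xss) → y ∈ map (x′ ∷ᵛ_) (choices xss) → x ≡ x′
  key p q with ∈.∈-map⁻ _ p | ∈.∈-map⁻ _ q
  ... | _ , _ , refl | _ , _ , refl = refl

∈-choices⁺ : ∀ {n} (xss : Vec (List A) n) (v : Vec A n) → (∀ i → lookup v i ∈ lookup xss i) → v ∈ choices xss
∈-choices⁺ []ᵛ []ᵛ _ = here refl
∈-choices⁺ (xs ∷ᵛ xss) (x ∷ᵛ v) p =
  ∈-concatMap⁺ _ (p fzero) (∈.∈-map⁺ _ (∈-choices⁺ xss v (p ∘ fsuc)))

∈-choices⁻ : ∀ {n} (xss : Vec (List A) n) (v : Vec A n) → v ∈ choices xss → ∀ i → lookup v i ∈ lookup xss i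
∈-choices⁻ (xs ∷ᵛ xss) v p i with ∈-concatMap⁻ _ xs p
... | x , x∈ , q with ∈.∈-map⁻ _ q
∈-choices⁻ (xs ∷ᵛ xss) v p fzero | x , x∈ , q | v′ , v′∈ , refl = x∈
∈-choices⁻ (xs ∷ᵛ xss) v p (fsuc i) | x , x∈ , q | v′ , v′∈ , refl = ∈-choices⁻ xss v′ v′∈ i

length-choices : ∀ {n} (xss : Vec (List A) n) {c : ℕ} → (∀ i → length (lookup xss i) ≡ c) →
  length (choices xss) ≡ c ^ n
length-choices []ᵛ _ = refl
length-choices {n = suc n} (xs ∷ᵛ xss) {c} l =
  trans (length-concatMap _ xs (λ x → trans (List.length-map _ (choices xss)) (length-choices xss (l ∘ fsuc))))
        (cong (_* c ^ n) (l fzero))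

perms : (k : ℕ) → List (List (Fin k))
perms zero    = [ [] ]
perms (suc k) = concatMap (λ i → map (λ p → i ∷ map (punchIn i) p) (perms k)) (allFin (suc k))

map-punchIn-injective : ∀ {k} (i : Fin (suc k)) {p q} → map (punchIn i) p ≡ map (punchIn i) q → p ≡ q
map-punchIn-injective i = List.map-injective (Fin.punchIn-injective i _ _)

length-perms : ∀ k → length (perms k) ≡ k !
length-perms zero    = refl
length-perms (suc k) = trans
  (length-concatMap (λ i → map (λ p → i ∷ map (punchIn i) p) (perms k)) (allFin (suc k)) (λ i → trans (List.length-map _ (perms k)) (length-perms k)))
  (cong (_* k !) (length-allFin (suc k)))

Unique-perms : ∀ k → Unique (perms k)
Unique-perms zero    = [] ∷ []
Unique-perms (suc k) = Unique-concatMap (Unique.allFin⁺ (suc k))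
  (λ i → Unique.map⁺ (map-punchIn-injective i ∘ List.∷-injectiveʳ) (Unique-perms k)) key
  where
  key : ∀ {i j y} → y ∈ map (λ p → i ∷ map (punchIn i) p) (perms k) →
        y ∈ map (λ p → j ∷ map (punchIn j) p) (perms k) → i ≡ j
  key p q with ∈.∈-map⁻ _ p | ∈.∈-map⁻ _ q
  ... | _ , _ , refl | _ , _ , eq = List.∷-injectiveˡ eq

punchIn-↭ : ∀ {k} (i : Fin (suc k)) → i ∷ map (punchIn i) (allFin k) ↭ allFin (suc k)
punchIn-↭ {k} i = Unique⇒↭-allFin
  (Unique-∷ (λ p → let j , _ , e = ∈.∈-map⁻ _ p in Fin.punchInᵢ≢i i j (sym e))
            (Unique.map⁺ (Fin.punchIn-injective i _ _) (Unique.allFin⁺ k)))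
  cover
  where
  cover : ∀ j → j ∈ i ∷ map (punchIn i) (allFin k)
  cover j with i Fin.≟ j
  ... | yes refl = here refl
  ... | no i≢j = there (subst (_∈ _) (Fin.punchIn-punchOut i≢j) (∈.∈-map⁺ _ (∈.∈-allFin (punchOut i≢j))))

∈-perms⁻ : ∀ k {xs} → xs ∈ perms k → xs ↭ allFin k
∈-perms⁻ zero (here refl) = ↭-refl
∈-perms⁻ (suc k) p with ∈-concatMap⁻ _ (allFin (suc k)) p
... | i , _ , q with ∈.∈-map⁻ _ q
... | ys , ys∈ , refl = ↭-trans (prep i (↭.map⁺ _ (∈-perms⁻ k ys∈))) (punchIn-↭ i)

∷-↭-allFin⁻ : ∀ {k i} {xs : List (Fin (suc k))} → i ∷ xs ↭ allFin (suc k) →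
  ∃[ ys ] xs ≡ map (punchIn i) ys × ys ↭ allFin k
∷-↭-allFin⁻ {k} {i} p with ↭.↭-map-inv (punchIn i) (↭.drop-∷ (↭-trans (punchIn-↭ i) (↭-sym p)))
... | ys , eq , q = ys , eq , ↭-sym q

∈-perms⁺ : ∀ k {xs} → xs ↭ allFin k → xs ∈ perms k
∈-perms⁺ zero p with ↭.↭-empty-inv p
... | refl = here refl
∈-perms⁺ (suc k) {[]} p = contradiction (↭-sym p) ↭.¬x∷xs↭[]
∈-perms⁺ (suc k) {i ∷ xs} p with ∷-↭-allFin⁻ p
... | ys , refl , q = ∈-concatMap⁺ _ (∈.∈-allFin i) (∈.∈-map⁺ _ (∈-perms⁺ k q))

permsStartingWith permsEndingWith : ∀ {k} → Fin (suc k) → List (List (Fin (suc k)))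
permsStartingWith {k} i = map (λ p → i ∷ map (punchIn i) p) (perms k)
permsEndingWith   {k} i = map (λ p → map (punchIn i) p ∷ʳ i) (perms k)

length-permsStartingWith : ∀ {k} (i : Fin (suc k)) → length (permsStartingWith i) ≡ k !
length-permsStartingWith {k} i = trans (List.length-map _ (perms k)) (length-perms k)

length-permsEndingWith : ∀ {k} (i : Fin (suc k)) → length (permsEndingWith i) ≡ k !
length-permsEndingWith {k} i = trans (List.length-map _ (perms k)) (length-perms k)

Unique-permsStartingWith : ∀ {k} (i : Fin (suc k)) → Unique (permsStartingWith i)
Unique-permsStartingWith {k} i =
  Unique.map⁺ (map-punchIn-injective i ∘ List.∷-injectiveʳ) (Unique-perms k)

Unique-permsEndingWith : ∀ {k} (i : Fin (suc k)) → Unique (permsEndingWith i)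
Unique-permsEndingWith {k} i =
  Unique.map⁺ (map-punchIn-injective i ∘ List.∷ʳ-injectiveˡ _ _) (Unique-perms k)

∈-permsStartingWith⁻ : ∀ {k i} {xs : List (Fin (suc k))} → xs ∈ permsStartingWith i →
  xs ↭ allFin (suc k) × ∃[ ys ] xs ≡ i ∷ ys
∈-permsStartingWith⁻ {i = i} p with ∈.∈-map⁻ _ p
... | ys , ys∈ , refl = ↭-trans (prep _ (↭.map⁺ _ (∈-perms⁻ _ ys∈))) (punchIn-↭ i) , _ , refl

∈-permsStartingWith⁺ : ∀ {k i} {xs : List (Fin (suc k))} → i ∷ xs ↭ allFin (suc k) →
  i ∷ xs ∈ permsStartingWith i
∈-permsStartingWith⁺ p with ∷-↭-allFin⁻ p
... | ys , refl , q = ∈.∈-map⁺ _ (∈-perms⁺ _ q)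

∈-permsEndingWith⁻ : ∀ {k i} {xs : List (Fin (suc k))} → xs ∈ permsEndingWith i →
  xs ↭ allFin (suc k) × ∃[ ys ] xs ≡ ys ∷ʳ i
∈-permsEndingWith⁻ {i = i} p with ∈.∈-map⁻ _ p
... | ys , ys∈ , refl =
  ↭-trans (↭-sym (↭.∷↭∷ʳ i _)) (↭-trans (prep _ (↭.map⁺ _ (∈-perms⁻ _ ys∈))) (punchIn-↭ i)) , _ , refl

∈-permsEndingWith⁺ : ∀ {k i} {xs : List (Fin (suc k))} → xs ∷ʳ i ↭ allFin (suc k) →
  xs ∷ʳ i ∈ permsEndingWith i
∈-permsEndingWith⁺ {i = i} {xs} p with ∷-↭-allFin⁻ (↭-trans (↭.∷↭∷ʳ i xs) p)
... | ys , refl , q = ∈.∈-map⁺ _ (∈-perms⁺ _ q)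

-- Edges and walks of the de Bruijn graph

module Fibre {E : Set} {n k : ℕ} (π : E → Fin n) (λ′ : E → Fin k) (mk : Fin n → Fin k → E)
  (mk-η : ∀ e → mk (π e) (λ′ e) ≡ e) (π-mk : ∀ v i → π (mk v i) ≡ v) (λ-mk : ∀ v i → λ′ (mk v i) ≡ i) where

  -- Used for both decompositions of an edge: with source and label it lists the labels leaving `u`,
  -- with target and letter the letters entering `u`. The order of `es` is kept, which turns a walk
  -- into one list of exits per vertex.
  fibre : Fin n → List E → List (Fin k)
  fibre u es = map λ′ (filter (λ e → π e Fin.≟ u) es)

  fibre-accept : ∀ {u e} es → π e ≡ u → fibre u (e ∷ es) ≡ λ′ e ∷ fibre u es
  fibre-accept {u} es eq = cong (map λ′) (List.filter-accept (λ e → π e Fin.≟ u) eq)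

  fibre-reject : ∀ {u e} es → π e ≢ u → fibre u (e ∷ es) ≡ fibre u es
  fibre-reject {u} es ne = cong (map λ′) (List.filter-reject (λ e → π e Fin.≟ u) ne)

  ∈-fibre⁺ : ∀ {e es} → e ∈ es → λ′ e ∈ fibre (π e) es
  ∈-fibre⁺ {e} e∈ = ∈.∈-map⁺ λ′ (∈.∈-filter⁺ (λ e′ → π e′ Fin.≟ π e) e∈ refl)

  ∈-fibre⁻ : ∀ {u i} es → i ∈ fibre u es → mk u i ∈ es
  ∈-fibre⁻ {u} es p with ∈.∈-map∘filter⁻ λ′ (λ e → π e Fin.≟ u) {xs = es} p
  ... | e , e∈ , refl , refl = subst (_∈ es) (sym (mk-η e)) e∈

  mk-∈-fibre⁺ : ∀ {u i es} → mk u i ∈ es → i ∈ fibre u es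
  mk-∈-fibre⁺ {u} {i} {es} p = subst₂ (λ a b → a ∈ fibre b es) (λ-mk u i) (π-mk u i) (∈-fibre⁺ p)

  Unique-fibre : ∀ u {es} → Unique es → Unique (fibre u es)
  Unique-fibre u {[]} _ = []
  Unique-fibre u {e ∷ es} (pe ∷ ues) with π e Fin.≟ u
  ... | no _ = Unique-fibre u ues
  ... | yes refl = Unique-∷
    (λ p → Unique-head (pe ∷ ues) (subst (_∈ es) (mk-η e) (∈-fibre⁻ es p)))
    (Unique-fibre u ues)

  Unique-fibre⁻ : ∀ {es} → (∀ u → Unique (fibre u es)) → Unique es
  Unique-fibre⁻ {[]} _ = []
  Unique-fibre⁻ {e ∷ es} uf =
    Unique-∷ (λ p → Unique-head (subst Unique (fibre-accept es refl) (uf (π e))) (∈-fibre⁺ p))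
             (Unique-fibre⁻ rest)
    where
    rest : ∀ u → Unique (fibre u es)
    rest u with π e Fin.≟ u | uf u
    ... | no _     | q = q
    ... | yes refl | _ ∷ q = q

  -- A repetition-free list of k elements of `Fin k` contains them all. For entries this says that a
  -- vertex entered k times has been entered by every edge into it.
  full-fibre : ∀ {u es} → Unique es → length (fibre u es) ≡ k → ∀ e → π e ≡ u → e ∈ es
  full-fibre {es = es} ues l e refl =
    subst (_∈ es) (mk-η e) (∈-fibre⁻ es (long-Unique⇒∈ (Unique-fibre (π e) ues) l (λ′ e)))

module Graph (k n : ℕ) where

  -- The edge v → (k v + i) mod n is the number k v + i = n a + w, with source v, label i, target w and letter a.
  Edge : Set
  Edge = Fin (k * n)

  opaque
    letter : Edge → Fin k
    letter = quotient n

    target : Edge → Fin n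
    target = remainder {k} n

    source : Edge → Fin n
    source e = quotient k (cast (ℕ.*-comm k n) e)

    label : Edge → Fin k
    label e = remainder {n} k (cast (ℕ.*-comm k n) e)

    edge : Fin n → Fin k → Edge
    edge v i = cast (ℕ.*-comm n k) (combine v i)

    edgeInto : Fin n → Fin k → Edge
    edgeInto v a = combine a v

    edgeInto-η : ∀ e → edgeInto (target e) (letter e) ≡ e
    edgeInto-η e = Fin.combine-remQuot {k} n e

    target-edgeInto : ∀ v a → target (edgeInto v a) ≡ v
    target-edgeInto v a = cong proj₂ (Fin.remQuot-combine a v)

    letter-edgeInto : ∀ v a → letter (edgeInto v a) ≡ a
    letter-edgeInto v a = cong proj₁ (Fin.remQuot-combine a v)

    edge-η : ∀ e → edge (source e) (label e) ≡ e
    edge-η e = trans (cong (cast (ℕ.*-comm n k)) (Fin.combine-remQuot {n} k (cast (ℕ.*-comm k n) e)))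
                     (Fin.cast-involutive (ℕ.*-comm n k) (ℕ.*-comm k n) e)

    remQuot-edge : ∀ v i → remQuot {n} k (cast (ℕ.*-comm k n) (edge v i)) ≡ (v , i)
    remQuot-edge v i = trans (cong (remQuot {n} k) (Fin.cast-involutive (ℕ.*-comm k n) (ℕ.*-comm n k) _)) (Fin.remQuot-combine v i)

    source-edge : ∀ v i → source (edge v i) ≡ v
    source-edge v i = cong proj₁ (remQuot-edge v i)

    label-edge : ∀ v i → label (edge v i) ≡ i
    label-edge v i = cong proj₂ (remQuot-edge v i)

    cast-combine : ∀ v i → cast (ℕ.*-comm n k) (combine v i) ≡ edge v i
    cast-combine v i = refl

    toℕ-edge : ∀ v i → toℕ (edge v i) ≡ k * toℕ v + toℕ i
    toℕ-edge v i = trans (Fin.toℕ-cast _ (combine v i)) (Fin.toℕ-combine v i)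

    edge-mono-< : ∀ {v w} i j → toℕ v < toℕ w → toℕ (edge v i) < toℕ (edge w j)
    edge-mono-< {v} {w} i j v<w = subst₂ _<_ (sym (Fin.toℕ-cast _ (combine v i))) (sym (Fin.toℕ-cast _ (combine w j)))
      (Fin.combine-monoˡ-< i j v<w)

    toℕ-edgeInto : ∀ v a → toℕ (edgeInto v a) ≡ n * toℕ a + toℕ v
    toℕ-edgeInto v a = Fin.toℕ-combine a v

    edgeInto-mono-< : ∀ {a b} v w → toℕ a < toℕ b → toℕ (edgeInto v a) < toℕ (edgeInto w b)
    edgeInto-mono-< v w a<b = Fin.combine-monoˡ-< v w a<b

  source-mono : ∀ {e f} → toℕ (source e) < toℕ (source f) → toℕ e < toℕ f
  source-mono {e} {f} lt = subst₂ (λ e f → toℕ e < toℕ f) (edge-η e) (edge-η f) (edge-mono-< (label e) (label f) lt)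

  -- The numbers n a + w with w < n are ordered by a and then by w. Combined with `source-mono`, a
  -- tie between the letters hands the comparison on to the edges that follow.
  <⇒letter-or-target-< : ∀ {e f} → toℕ e < toℕ f →
    toℕ (letter e) < toℕ (letter f) ⊎ (letter e ≡ letter f × toℕ (target e) < toℕ (target f))
  <⇒letter-or-target-< {e} {f} lt with Fin.<-cmp (letter e) (letter f)
  ... | tri< a<b _ _ = inj₁ a<b
  ... | tri> _ _ b<a = contradiction
    (subst₂ (λ e f → toℕ e < toℕ f) (edgeInto-η f) (edgeInto-η e) (edgeInto-mono-< (target f) (target e) b<a)) (ℕ.<-asym lt)
  ... | tri≈ _ a≡b _ = inj₂ (a≡b , ℕ.+-cancelˡ-< (n * toℕ (letter e)) _ _ (subst₂ _<_ (toℕ≡ e)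
    (trans (toℕ≡ f) (cong (λ a → n * toℕ a + toℕ (target f)) (sym a≡b))) lt))
    where
    toℕ≡ : ∀ e → toℕ e ≡ n * toℕ (letter e) + toℕ (target e)
    toℕ≡ e = trans (cong toℕ (sym (edgeInto-η e))) (toℕ-edgeInto (target e) (letter e))

  open Fibre source label edge edge-η source-edge label-edge public
    using () renaming (fibre to exits; fibre-accept to exits-accept; fibre-reject to exits-reject;
      mk-∈-fibre⁺ to edge-∈-exits⁺; ∈-fibre⁻ to ∈-exits⁻;
      Unique-fibre to Unique-exits; Unique-fibre⁻ to Unique-exits⁻)

  open Fibre target letter edgeInto edgeInto-η target-edgeInto letter-edgeInto public
    using () renaming (fibre to entries;
      Unique-fibre to Unique-entries; full-fibre to full-entries)

  data Walk : Fin n → List Edge → Fin n → Set where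
    nil  : ∀ {v} → Walk v [] v
    step : ∀ {v w e es} → source e ≡ v → Walk (target e) es w → Walk v (e ∷ es) w

  walk-determined : ∀ {v w w′ es fs} → Walk v es w → Walk v fs w′ →
    (∀ u → exits u es ≡ exits u fs) → es ≡ fs
  walk-determined nil nil _ = refl
  walk-determined {v} nil (step {es = fs} refl _) eq with trans (eq v) (exits-accept fs refl)
  ... | ()
  walk-determined {v} (step {es = es} refl _) nil eq with trans (sym (exits-accept es refl)) (eq v)
  ... | ()
  walk-determined (step {e = e} {es} refl W) (step {e = f} {fs} sf W′) eq = go e≡f W′ rest
    where
    heads : label e ∷ exits (source e) es ≡ label f ∷ exits (source e) fs
    heads = trans (sym (exits-accept es refl)) (trans (eq _) (exits-accept fs sf))
    e≡f : e ≡ f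
    e≡f = trans (sym (edge-η e)) (trans (cong₂ edge (sym sf) (List.∷-injectiveˡ heads)) (edge-η f))
    rest : ∀ u → exits u es ≡ exits u fs
    rest u with source e Fin.≟ u
    ... | yes refl = List.∷-injectiveʳ heads
    ... | no ne = trans (sym (exits-reject es ne)) (trans (eq u) (exits-reject fs (ne ∘ trans (sym sf))))
    go : e ≡ f → ∀ {x} → Walk (target f) fs x → (∀ u → exits u es ≡ exits u fs) → e ∷ es ≡ f ∷ fs
    go refl W′ r = cong (e ∷_) (walk-determined W W′ r)

  δ : Fin n → Fin n → ℕ
  δ u v = if does (v Fin.≟ u) then 1 else 0

  δ-refl : ∀ u → δ u u ≡ 1
  δ-refl u with u Fin.≟ u
  ... | yes _ = refl
  ... | no ¬p = contradiction refl ¬p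

  δ-≢ : ∀ {u v} → v ≢ u → δ u v ≡ 0
  δ-≢ {u} {v} ne with v Fin.≟ u
  ... | yes p = contradiction p ne
  ... | no _ = refl

  length-exits-∷ : ∀ u e es → length (exits u (e ∷ es)) ≡ δ u (source e) + length (exits u es)
  length-exits-∷ u e es with source e Fin.≟ u
  ... | yes _ = refl
  ... | no _ = refl

  length-entries-∷ : ∀ u e es → length (entries u (e ∷ es)) ≡ δ u (target e) + length (entries u es)
  length-entries-∷ u e es with target e Fin.≟ u
  ... | yes _ = refl
  ... | no _ = refl

  -- Each arrival is matched by the departure along the following edge; only the start and the end
  -- of the walk are unmatched.
  walk-balance : ∀ {v w es} u → Walk v es w →
    δ u v + length (entries u es) ≡ length (exits u es) + δ u w
  walk-balance {v} u nil = ℕ.+-identityʳ (δ u v)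
  walk-balance {w = w} u (step {e = e} {es} refl W) = begin
    δ u (source e) + length (entries u (e ∷ es))
      ≡⟨ cong (δ u (source e) +_) (trans (length-entries-∷ u e es) (walk-balance u W)) ⟩
    δ u (source e) + (length (exits u es) + δ u w)
      ≡⟨ ℕ.+-assoc (δ u (source e)) _ _ ⟨
    δ u (source e) + length (exits u es) + δ u w
      ≡⟨ cong (_+ δ u w) (length-exits-∷ u e es) ⟨
    length (exits u (e ∷ es)) + δ u w ∎
    where open ≡-Reasoning

  Unique-covering : ∀ {es} → Unique es → (∀ u → exits u es ↭ allFin k) → es ↭ allFin (k * n)
  Unique-covering {es} ues full = Unique⇒↭-allFin ues λ e →
    subst (_∈ es) (edge-η e) (∈-exits⁻ es (↭.∈-resp-↭ (↭-sym (full _)) (∈.∈-allFin _)))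

  covering-exits : ∀ {es} → es ↭ allFin (k * n) → ∀ u → exits u es ↭ allFin k
  covering-exits {es} p u = Unique⇒↭-allFin
    (Unique-exits u (Unique-resp-↭ (↭-sym p) (Unique.allFin⁺ (k * n))))
    (λ i → edge-∈-exits⁺ (↭.∈-resp-↭ (↭-sym p) (∈.∈-allFin _)))

-- Greedy walks along prescribed exit orders

-- The number of labels left over all vertices. It drops by one with each step of `greedy-walk` and
-- so bounds the length of the walk.
total : ∀ {n} {A : Set} → (Fin n → List A) → ℕ
total {zero}  L = 0
total {suc n} L = length (L fzero) + total (L ∘ fsuc)

total-cong : ∀ {n} {A : Set} {L L′ : Fin n → List A} → (∀ u → L u ≡ L′ u) → total L ≡ total L′
total-cong {zero}  eq = refl
total-cong {suc n} eq = cong₂ _+_ (cong length (eq fzero)) (total-cong (eq ∘ fsuc))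

pop : ∀ {n} {A : Set} → Fin n → List A → (Fin n → List A) → Fin n → List A
pop v is L u with v Fin.≟ u
... | yes _ = is
... | no _  = L u

pop-≡ : ∀ {n} {A : Set} (v : Fin n) {is : List A} L → pop v is L v ≡ is
pop-≡ v L with v Fin.≟ v
... | yes _ = refl
... | no ¬p = contradiction refl ¬p

pop-≢ : ∀ {n} {A : Set} {v u : Fin n} {is : List A} L → v ≢ u → pop v is L u ≡ L u
pop-≢ {v = v} {u} L ne with v Fin.≟ u
... | yes p = contradiction p ne
... | no _ = refl

total-pop : ∀ {n} {A : Set} (v : Fin n) {i : A} {is} L → L v ≡ i ∷ is → total L ≡ suc (total (pop v is L))
total-pop fzero L eq rewrite eq = refl
total-pop {suc n} (fsuc v) {i} {is} L eq = begin
  length (L fzero) + total (L ∘ fsuc)                      ≡⟨ cong (length (L fzero) +_) (total-pop v (L ∘ fsuc) eq) ⟩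
  length (L fzero) + suc (total (pop v is (L ∘ fsuc)))     ≡⟨ ℕ.+-suc _ _ ⟩
  suc (length (L fzero) + total (pop v is (L ∘ fsuc)))     ≡⟨ cong (λ t → suc (length (L fzero) + t)) (total-cong pop-fsuc) ⟩
  suc (length (L fzero) + total (pop (fsuc v) is L ∘ fsuc)) ∎
  where
  open ≡-Reasoning
  pop-fsuc : ∀ u → pop v is (L ∘ fsuc) u ≡ pop (fsuc v) is L (fsuc u)
  pop-fsuc u with v Fin.≟ u
  ... | yes _ = refl
  ... | no _ = refl

module _ (k n : ℕ) where
  open Graph k n

  greedy-walk : ∀ t (L : Fin n → List (Fin k)) v → total L ≡ t →
    Σ (List Edge) λ es → Σ (Fin n) λ w → Σ (Fin n → List (Fin k)) λ R →
      Walk v es w × (∀ u → exits u es ++ R u ≡ L u) × R w ≡ []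
  greedy-walk t L v tot with L v in Lv
  ... | [] = [] , v , L , nil , (λ _ → refl) , Lv
  greedy-walk zero L v tot | i ∷ is with trans (sym tot) (total-pop v L Lv)
  ... | ()
  greedy-walk (suc t) L v tot | i ∷ is
    with greedy-walk t (pop v is L) (target (edge v i)) (ℕ.suc-injective (trans (sym (total-pop v L Lv)) tot))
  ... | es , w , R , W , sp , Rw = edge v i ∷ es , w , R , step (source-edge v i) W , split , Rw
    where
    split : ∀ u → exits u (edge v i ∷ es) ++ R u ≡ L u
    split u with v Fin.≟ u
    ... | yes refl = begin
      exits v (edge v i ∷ es) ++ R v          ≡⟨ cong (_++ R v) (exits-accept es (source-edge v i)) ⟩
      label (edge v i) ∷ (exits v es ++ R v)  ≡⟨ cong₂ _∷_ (label-edge v i) (trans (sp v) (pop-≡ v L)) ⟩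
      i ∷ is                                  ≡⟨ Lv ⟨
      L v                                     ∎
      where open ≡-Reasoning
    ... | no ne = trans (cong (_++ R u) (exits-reject es (ne ∘ trans (sym (source-edge v i)))))
                        (trans (sp u) (pop-≢ L ne))

-- A nonempty remainder would end in `c`, which the prefix already contains. For the exits of a
-- vertex: once the exit ranked last has been taken, so have all the others.
++-exhausts-last : ∀ {A : Set} (xs ys zs : List A) {c} → Unique (zs ∷ʳ c) → xs ++ ys ≡ zs ∷ʳ c → c ∈ xs → ys ≡ []
++-exhausts-last xs ys zs u eq c∈ with initLast ys
... | [] = refl
... | ys′ ∷ʳ′ y with List.∷ʳ-injectiveʳ (xs ++ ys′) zs (trans (List.++-assoc xs ys′ [ y ]) eq)
... | refl = contradiction (∈.∈-++⁺ʳ ys′ (here refl)) (Unique-++⁻-disjoint xs (subst Unique (sym eq) u) c∈)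

-- Iteration of a map that fixes the root

iter-shift : ∀ {A : Set} i (f : A → A) x → iter i f (f x) ≡ iter (suc i) f x
iter-shift zero    f x = refl
iter-shift (suc i) f x = cong f (iter-shift i f x)

iter-+ : ∀ {A : Set} i j (f : A → A) x → iter (i + j) f x ≡ iter i f (iter j f x)
iter-+ zero    j f x = refl
iter-+ (suc i) j f x = cong f (iter-+ i j f x)

module _ {m : ℕ} (f : Fin (suc m) → Fin (suc m)) (f0 : f fzero ≡ fzero) where

  iter-root : ∀ i → iter i f fzero ≡ fzero
  iter-root zero    = refl
  iter-root (suc i) = trans (cong f (iter-root i)) f0

  iter-stays : ∀ {x i j} → i ≤ j → iter i f x ≡ fzero → iter j f x ≡ fzero
  iter-stays {x} {i} {j} i≤j eq = begin
    iter j f x               ≡⟨ cong (λ t → iter t f x) (ℕ.m∸n+n≡m i≤j) ⟨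
    iter (j ∸ i + i) f x     ≡⟨ iter-+ (j ∸ i) i f x ⟩
    iter (j ∸ i) f (iter i f x) ≡⟨ cong (iter (j ∸ i) f) eq ⟩
    iter (j ∸ i) f fzero     ≡⟨ iter-root (j ∸ i) ⟩
    fzero                    ∎
    where open ≡-Reasoning

  -- Among the first n + 1 iterates two agree, so a longer path to the root can be shortened.
  iter-short : ∀ fuel t x → t ≤ fuel → iter t f x ≡ fzero → iter (suc m) f x ≡ fzero
  iter-short fuel t x t≤ eq with t ℕ.≤? suc m
  ... | yes t≤n = iter-stays t≤n eq
  iter-short zero zero x t≤ eq | no t≰n = contradiction z≤n t≰n
  iter-short (suc fuel) t x t≤ eq | no t≰n
    with Fin.pigeonhole (ℕ.n<1+n (suc m)) (λ i → iter (toℕ i) f x)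
  ... | i , j , i<j , same = iter-short fuel (t ∸ toℕ j + toℕ i) x shorter (begin
    iter (t ∸ toℕ j + toℕ i) f x          ≡⟨ iter-+ (t ∸ toℕ j) (toℕ i) f x ⟩
    iter (t ∸ toℕ j) f (iter (toℕ i) f x) ≡⟨ cong (iter (t ∸ toℕ j) f) same ⟩
    iter (t ∸ toℕ j) f (iter (toℕ j) f x) ≡⟨ iter-+ (t ∸ toℕ j) (toℕ j) f x ⟨
    iter (t ∸ toℕ j + toℕ j) f x          ≡⟨ cong (λ s → iter s f x) (ℕ.m∸n+n≡m j≤t) ⟩
    iter t f x                            ≡⟨ eq ⟩
    fzero                                 ∎)
    where
    open ≡-Reasoning
    j≤t : toℕ j ≤ t
    j≤t = ℕ.≤-trans (ℕ.≤-pred (Fin.toℕ<n j)) (ℕ.<⇒≤ (ℕ.≰⇒> t≰n))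
    shorter : t ∸ toℕ j + toℕ i ≤ fuel
    shorter = ℕ.≤-pred (ℕ.≤-trans
      (ℕ.<-≤-trans (ℕ.+-monoʳ-< (t ∸ toℕ j) i<j) (ℕ.≤-reflexive (ℕ.m∸n+n≡m j≤t))) t≤)

-- Boolean tests and enumerations

T⇒≡true : ∀ {b} → T b → b ≡ true
T⇒≡true {true} _ = refl

≡true⇒T : ∀ {b} → b ≡ true → T b
≡true⇒T refl = _

∧-true⁻ : ∀ {a b} → a ∧ b ≡ true → a ≡ true × b ≡ true
∧-true⁻ {true} {true} _ = refl , refl

allᵇ⁺ : ∀ {A : Set} (p : A → Bool) xs → (∀ x → x ∈ xs → p x ≡ true) → allᵇ p xs ≡ true
allᵇ⁺ p [] _ = refl
allᵇ⁺ p (x ∷ xs) h = cong₂ _∧_ (h x (here refl)) (allᵇ⁺ p xs (λ y → h y ∘ there))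

allᵇ⁻ : ∀ {A : Set} (p : A → Bool) xs → allᵇ p xs ≡ true → ∀ {x} → x ∈ xs → p x ≡ true
allᵇ⁻ p (x ∷ xs) h (here refl) = proj₁ (∧-true⁻ h)
allᵇ⁻ p (x ∷ xs) h (there q) = allᵇ⁻ p xs (proj₂ (∧-true⁻ {p x} h)) q

Unique-allVecs : ∀ k N → Unique (allVecs k N)
Unique-allVecs k zero = [] ∷ []
Unique-allVecs k (suc N) = Unique-concatMap (Unique.allFin⁺ k)
  (λ a → Unique.map⁺ Vec.∷-injectiveʳ (Unique-allVecs k N)) key
  where
  key : ∀ {a b v} → v ∈ map (a ∷ᵛ_) (allVecs k N) → v ∈ map (b ∷ᵛ_) (allVecs k N) → a ≡ b
  key p q with ∈.∈-map⁻ _ p | ∈.∈-map⁻ _ q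
  ... | _ , _ , refl | _ , _ , refl = refl

∈-allVecs : ∀ k {N} (v : Vec (Fin k) N) → v ∈ allVecs k N
∈-allVecs k []ᵛ = here refl
∈-allVecs k (a ∷ᵛ v) = ∈-concatMap⁺ _ (∈.∈-allFin a) (∈.∈-map⁺ _ (∈-allVecs k v))

∈-filterᵇ⁺ : ∀ {A : Set} (p : A → Bool) {x xs} → x ∈ xs → p x ≡ true → x ∈ filterᵇ p xs
∈-filterᵇ⁺ p x∈ px = ∈.∈-filter⁺ (T? ∘ p) x∈ (≡true⇒T px)

∈-filterᵇ⁻ : ∀ {A : Set} (p : A → Bool) {x xs} → x ∈ filterᵇ p xs → x ∈ xs × p x ≡ true
∈-filterᵇ⁻ p {xs = xs} x∈ with ∈.∈-filter⁻ (T? ∘ p) {xs = xs} x∈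
... | x∈xs , px = x∈xs , T⇒≡true px

Unique-filterᵇ : ∀ {A : Set} (p : A → Bool) {xs} → Unique xs → Unique (filterᵇ p xs)
Unique-filterᵇ p = Unique.filter⁺ (T? ∘ p)

lookup-ext : ∀ {A : Set} {n} {u v : Vec A n} → (∀ i → lookup u i ≡ lookup v i) → u ≡ v
lookup-ext {u = u} {v} eq =
  trans (sym (Vec.tabulate∘lookup u)) (trans (Vec.tabulate-cong eq) (Vec.tabulate∘lookup v))

module _ {k m : ℕ} where

  isOrientedTree⁺ : (c : Vec (Fin k) m) → (∀ v → iter (suc m) (treeStep k m c) v ≡ fzero) →
    isOrientedTree k m c ≡ true
  isOrientedTree⁺ c h = allᵇ⁺ _ (allFin (suc m)) (λ v _ → cong (λ u → toℕ u ≡ᵇ 0) (h v))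

  isOrientedTree⁻ : (c : Vec (Fin k) m) → isOrientedTree k m c ≡ true →
    ∀ v → iter (suc m) (treeStep k m c) v ≡ fzero
  isOrientedTree⁻ c h v = Fin.toℕ-injective (ℕ.≡ᵇ⇒≡ _ _ (≡true⇒T (allᵇ⁻ (λ v → toℕ (iter (suc m) (treeStep k m c) v) ≡ᵇ 0) (allFin (suc m)) h (∈.∈-allFin v))))

-- Euler tours, oriented trees and exit orders

module EulerTours (k m : ℕ) where
  open Graph (suc k) (suc m) public

  target-mod : ∀ e → toℕ e mod (suc m) ≡ target e
  target-mod e = Fin.toℕ-injective (begin
    toℕ (toℕ e mod (suc m))                                ≡⟨ Fin.toℕ-fromℕ< _ ⟩
    toℕ e % suc m                                          ≡⟨ cong (λ e′ → toℕ e′ % suc m) (edgeInto-η e) ⟨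
    toℕ (edgeInto (target e) (letter e)) % suc m           ≡⟨ cong (_% suc m) (toℕ-edgeInto (target e) (letter e)) ⟩
    (suc m * toℕ (letter e) + toℕ (target e)) % suc m      ≡⟨ cong (_% suc m) (trans (ℕ.+-comm (suc m * toℕ (letter e)) _)
                                                                 (cong (toℕ (target e) +_) (ℕ.*-comm (suc m) _))) ⟩
    (toℕ (target e) + toℕ (letter e) * suc m) % suc m      ≡⟨ [m+kn]%n≡m%n (toℕ (target e)) (toℕ (letter e)) (suc m) ⟩
    toℕ (target e) % suc m                                 ≡⟨ m<n⇒m%n≡m (Fin.toℕ<n (target e)) ⟩
    toℕ (target e)                                         ∎)
    where open ≡-Reasoning

  treeStep-target : ∀ c j → treeStep (suc k) m c (fsuc j) ≡ target (edge (fsuc j) (lookup c j))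
  treeStep-target c j = trans (cong (_mod suc m) (sym (toℕ-edge (fsuc j) (lookup c j)))) (target-mod (edge (fsuc j) (lookup c j)))

  record Tour (es : List Edge) : Set where
    field
      closed : Walk fzero es fzero
      covers : es ↭ allFin (suc k * suc m)
      starts : ∃[ es′ ] es ≡ edge fzero fzero ∷ es′

  Orders : Set
  Orders = Vec (List (Fin (suc k))) (suc m)

  -- The admissible orders in which a tour uses the labels at the vertices: 0 first at the root, the tree edge last elsewhere.
  options : Vec (Fin (suc k)) m → Vec (List (List (Fin (suc k)))) (suc m)
  options c = permsStartingWith fzero ∷ᵛ Vec.map permsEndingWith c

  families : List Orders
  families = concatMap (choices ∘ options) (filterᵇ (isOrientedTree (suc k) m) (allVecs (suc k) m))

  options-suc : ∀ c j → lookup (options c) (fsuc j) ≡ permsEndingWith (lookup c j)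
  options-suc c j = Vec.lookup-map j permsEndingWith c

  ∈-choices-options⁻ : ∀ {L : Orders} c → L ∈ choices (options c) → ∀ j →
    lookup L (fsuc j) ↭ allFin (suc k) × ∃[ ys ] lookup L (fsuc j) ≡ ys ∷ʳ lookup c j
  ∈-choices-options⁻ {L} c p j =
    ∈-permsEndingWith⁻ (subst (lookup L (fsuc j) ∈_) (options-suc c j) (∈-choices⁻ (options c) L p (fsuc j)))

  -- The last entries of the lists away from the root spell the tree, so different trees admit
  -- disjoint sets of orders.
  Unique-families : Unique families
  Unique-families = Unique-concatMap (Unique-filterᵇ (isOrientedTree (suc k) m) (Unique-allVecs (suc k) m))
    (λ c → Unique-choices (options c) (Unique-options c)) same-tree
    where
    Unique-options : ∀ c i → Unique (lookup (options c) i)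
    Unique-options c fzero    = Unique-permsStartingWith fzero
    Unique-options c (fsuc j) = subst Unique (sym (options-suc c j)) (Unique-permsEndingWith (lookup c j))
    same-tree : ∀ {c c′ L} → L ∈ choices (options c) → L ∈ choices (options c′) → c ≡ c′
    same-tree {c} {c′} p q = lookup-ext λ j →
      let _ , ys , eq = ∈-choices-options⁻ c p j ; _ , ys′ , eq′ = ∈-choices-options⁻ c′ q j
      in List.∷ʳ-injectiveʳ ys ys′ (trans (sym eq) eq′)

  length-families : length families ≡ (k !) ^ suc m * κDB (suc k) (suc m)
  length-families = trans
    (length-concatMap (choices ∘ options) (filterᵇ (isOrientedTree (suc k) m) (allVecs (suc k) m))
      (λ c → length-choices (options c) (length-options c)))
    (ℕ.*-comm (κDB (suc k) (suc m)) ((k !) ^ suc m))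
    where
    length-options : ∀ c i → length (lookup (options c) i) ≡ k !
    length-options c fzero    = length-permsStartingWith {k} fzero
    length-options c (fsuc j) = trans (cong length (options-suc c j)) (length-permsEndingWith (lookup c j))

  exits-∷ʳ : ∀ {u ys i} e es → exits u es ≡ ys ∷ʳ i → ∃[ zs ] exits u (e ∷ es) ≡ zs ∷ʳ i
  exits-∷ʳ {u} {ys} {i} e es eq with source e Fin.≟ u
  ... | yes _ = label e ∷ ys , cong (label e ∷_) eq
  ... | no _  = ys , eq

  exits-∷-[] : ∀ {u} e es → exits u es ≡ [] → u ≡ source e ⊎ (∃[ i ] i ∈ exits u (e ∷ es)) → u ≡ source e
  exits-∷-[] e es eq (inj₁ p) = p
  exits-∷-[] {u} e es eq (inj₂ (i , i∈)) with source e Fin.≟ u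
  ... | yes p = sym p
  ... | no _ with subst (i ∈_) eq i∈
  ... | ()

  -- In a walk ending at the root, the walk after the last exit from u ≠ 0 shows that the last exits lead from u to the root.
  last-exits-reach-root : ∀ {v es} (g : Fin (suc m) → Fin (suc m)) → Walk v es fzero →
    (∀ u ys i → u ≢ fzero → exits u es ≡ ys ∷ʳ i → g u ≡ target (edge u i)) →
    ∀ u → u ≡ v ⊎ (∃[ i ] i ∈ exits u es) → ∃[ t ] iter t g u ≡ fzero
  last-exits-reach-root g nil _ u (inj₁ eq) = 0 , eq
  last-exits-reach-root g (step {e = e} {es} refl W) last u reason with u Fin.≟ fzero
  ... | yes u≡0 = 0 , u≡0
  ... | no u≢0 with exits u es in eq
  ... | i ∷ _ = last-exits-reach-root g W (λ v ys i v≢0 p → last v _ i v≢0 (proj₂ (exits-∷ʳ e es p))) u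
                  (inj₂ (i , subst (i ∈_) (sym eq) (here refl)))
  ... | [] with exits-∷-[] e es eq reason
  ... | refl with last-exits-reach-root g W (λ v ys i v≢0 p → last v _ i v≢0 (proj₂ (exits-∷ʳ e es p))) (target e) (inj₁ refl)
  ... | t , reached = suc t , trans (sym (iter-shift t g (source e))) (trans (cong (iter t g) g≡) reached)
    where
    g≡ : g (source e) ≡ target e
    g≡ = trans (last (source e) [] (label e) u≢0 (trans (exits-accept es refl) (cong (label e ∷_) eq)))
               (cong target (edge-η e))

  ↭-allFin-∷ʳ : ∀ {xs : List (Fin (suc k))} → xs ↭ allFin (suc k) → ∃₂ λ ys i → xs ≡ ys ∷ʳ i
  ↭-allFin-∷ʳ {xs} p with initLast xs
  ... | [] = contradiction (↭-sym p) ↭.¬x∷xs↭[]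
  ... | ys ∷ʳ′ i = ys , i , refl

  tour⇒family : ∀ {es} → Tour es → Vec.tabulate (λ u → exits u es) ∈ families
  tour⇒family {es} tour = ∈-concatMap⁺ (choices ∘ options) {x = c}
    (∈-filterᵇ⁺ (isOrientedTree (suc k) m) (∈-allVecs (suc k) c) (isOrientedTree⁺ c reaches-root))
    (∈-choices⁺ (options c) (Vec.tabulate (λ u → exits u es)) allowed)
    where
    open Tour tour
    perm : ∀ u → exits u es ↭ allFin (suc k)
    perm = covering-exits covers
    ending : ∀ j → ∃₂ λ ys i → exits (fsuc j) es ≡ ys ∷ʳ i
    ending j = ↭-allFin-∷ʳ (perm (fsuc j))
    lastExit : Fin m → Fin (suc k)
    lastExit j = proj₁ (proj₂ (ending j))
    c : Vec (Fin (suc k)) m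
    c = Vec.tabulate lastExit
    at-root : exits fzero es ∈ permsStartingWith fzero
    at-root with starts
    ... | es′ , refl = subst (_∈ permsStartingWith fzero) (sym eq)
      (∈-permsStartingWith⁺ (subst (_↭ allFin (suc k)) eq (perm fzero)))
      where
      eq : exits fzero (edge fzero fzero ∷ es′) ≡ fzero ∷ exits fzero es′
      eq = trans (exits-accept es′ (source-edge fzero fzero)) (cong (_∷ exits fzero es′) (label-edge fzero fzero))
    allowed : ∀ u → lookup (Vec.tabulate (λ u → exits u es)) u ∈ lookup (options c) u
    allowed fzero    = at-root
    allowed (fsuc j) = subst₂ _∈_ (sym (Vec.lookup∘tabulate (λ u → exits u es) (fsuc j)))
      (trans (cong permsEndingWith (sym (Vec.lookup∘tabulate lastExit j))) (sym (options-suc c j)))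
      (subst (_∈ permsEndingWith (lastExit j)) (sym (proj₂ (proj₂ (ending j))))
        (∈-permsEndingWith⁺ (subst (_↭ allFin (suc k)) (proj₂ (proj₂ (ending j))) (perm (fsuc j)))))
    follows : ∀ u ys i → u ≢ fzero → exits u es ≡ ys ∷ʳ i → treeStep (suc k) m c u ≡ target (edge u i)
    follows fzero ys i u≢0 eq = contradiction refl u≢0
    follows (fsuc j) ys i _ eq = trans (treeStep-target c j) (cong (λ i → target (edge (fsuc j) i))
      (trans (Vec.lookup∘tabulate lastExit j) (List.∷ʳ-injectiveʳ _ ys (trans (sym (proj₂ (proj₂ (ending j)))) eq))))
    reaches-root : ∀ v → iter (suc m) (treeStep (suc k) m c) v ≡ fzero
    -- The tour leaves every vertex, for instance by label 0, so the path of last exits reaches the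
    -- root after some number `t` of steps; `iter-short` turns `t` into the number of steps that
    -- `isOrientedTree` tests.
    reaches-root v with last-exits-reach-root (treeStep (suc k) m c) closed follows v
      (inj₂ (fzero , ↭.∈-resp-↭ (↭-sym (perm v)) (∈.∈-allFin _)))
    ... | t , eq = iter-short (treeStep (suc k) m c) refl t t v ℕ.≤-refl eq

  -- The greedy walk follows the orders as far as it goes, and the point is that it uses everything
  -- up. It stops at the root, which is therefore exhausted, and exhaustion spreads through the tree
  -- from each vertex to its children.
  family⇒tour : ∀ {L} → L ∈ families → ∃[ es ] Tour es × (∀ u → exits u es ≡ lookup L u)
  family⇒tour {L} L∈ with ∈-concatMap⁻ (choices ∘ options) (filterᵇ (isOrientedTree (suc k) m) (allVecs (suc k) m)) L∈
  ... | c , c∈ , L∈c with ∈-permsStartingWith⁻ (∈-choices⁻ (options c) L L∈c fzero)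
  ... | perm₀ , ys₀ , L₀≡ with greedy-walk (suc k) (suc m) _ (lookup L) fzero refl
  ... | es , w , R , W , split , Rw = es , record { closed = subst (Walk fzero es) w≡0 W ; covers = Unique-covering Ues exits-perm ; starts = starts W exits₀ } , exits≡
    where
    tree : ∀ v → iter (suc m) (treeStep (suc k) m c) v ≡ fzero
    tree = isOrientedTree⁻ c (proj₂ (∈-filterᵇ⁻ (isOrientedTree (suc k) m) {xs = allVecs (suc k) m} c∈))
    ending : ∀ j → lookup L (fsuc j) ↭ allFin (suc k) × ∃[ ys ] lookup L (fsuc j) ≡ ys ∷ʳ lookup c j
    ending j = ∈-choices-options⁻ c L∈c j
    perm : ∀ u → lookup L u ↭ allFin (suc k)
    perm fzero = perm₀
    perm (fsuc j) = proj₁ (ending j)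
    UL : ∀ u → Unique (lookup L u)
    UL u = Unique-resp-↭ (↭-sym (perm u)) (Unique.allFin⁺ (suc k))
    Ues : Unique es
    Ues = Unique-exits⁻ (λ u → Unique-++⁻ˡ (exits u es) (subst Unique (sym (split u)) (UL u)))
    exhausted⇒full : ∀ u → R u ≡ [] → length (exits u es) ≡ suc k
    exhausted⇒full u eq = trans (cong length (trans (sym (List.++-identityʳ (exits u es))) (trans (cong (exits u es ++_) (sym eq)) (split u))))
      (trans (↭.↭-length (perm u)) (length-allFin (suc k)))
    -- Elsewhere the walk would have entered w once more than it left it, that is, k + 1 times.
    w≡0 : w ≡ fzero
    w≡0 with w Fin.≟ fzero
    ... | yes eq = eq
    ... | no ne = contradiction (Unique-length≤ (Unique-entries w Ues)) (ℕ.<⇒≱ (ℕ.≤-reflexive (sym too-many)))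
      where
      open ≡-Reasoning
      too-many : length (entries w es) ≡ suc (suc k)
      too-many = begin
        length (entries w es)              ≡⟨ cong (_+ length (entries w es)) (δ-≢ (ne ∘ sym)) ⟨
        δ w fzero + length (entries w es)  ≡⟨ walk-balance w W ⟩
        length (exits w es) + δ w w        ≡⟨ cong₂ _+_ (exhausted⇒full w Rw) (δ-refl w) ⟩
        suc k + 1                          ≡⟨ ℕ.+-comm (suc k) 1 ⟩
        suc (suc k)                        ∎
    balanced : ∀ u → length (entries u es) ≡ length (exits u es)
    balanced u = ℕ.+-cancelˡ-≡ (δ u fzero) _ _ (trans (walk-balance u W)
      (trans (ℕ.+-comm (length (exits u es)) (δ u w)) (cong (λ w → δ u w + length (exits u es)) w≡0)))
    -- If the tree target of u is exhausted, all edges into it are used, among them the edge ranked last at u.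
    exhausted : ∀ t u → iter t (treeStep (suc k) m c) u ≡ fzero → R u ≡ []
    exhausted zero u refl = subst (λ w → R w ≡ []) w≡0 Rw
    exhausted (suc t) fzero _ = subst (λ w → R w ≡ []) w≡0 Rw
    exhausted (suc t) (fsuc j) eq = ++-exhausts-last (exits (fsuc j) es) (R (fsuc j)) (proj₁ (proj₂ (ending j)))
      (subst Unique (proj₂ (proj₂ (ending j))) (UL (fsuc j)))
      (trans (split (fsuc j)) (proj₂ (proj₂ (ending j))))
      (edge-∈-exits⁺ (full-entries Ues (trans (balanced _) (exhausted⇒full _ next)) _ (sym (treeStep-target c j))))
      where
      next : R (treeStep (suc k) m c (fsuc j)) ≡ []
      next = exhausted t _ (trans (iter-shift t (treeStep (suc k) m c) (fsuc j)) eq)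
    exits≡ : ∀ u → exits u es ≡ lookup L u
    exits≡ u = trans (sym (List.++-identityʳ _)) (trans (cong (exits u es ++_) (sym (exhausted (suc m) u (tree u)))) (split u))
    exits-perm : ∀ u → exits u es ↭ allFin (suc k)
    exits-perm u = subst (_↭ allFin (suc k)) (sym (exits≡ u)) (perm u)
    exits₀ : exits fzero es ≡ fzero ∷ ys₀
    exits₀ = trans (exits≡ fzero) L₀≡
    starts : ∀ {es} → Walk fzero es w → exits fzero es ≡ fzero ∷ ys₀ → ∃[ es′ ] es ≡ edge fzero fzero ∷ es′
    starts (step {e = e} {es′} se _) eq = es′ , cong (_∷ es′)
      (trans (sym (edge-η e)) (cong₂ edge se (List.∷-injectiveˡ (trans (sym (exits-accept es′ se)) eq))))

-- Lexicographic order and sorting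

infix 4 _≼_
_≼_ : ∀ {k} → Word k → Word k → Set
u ≼ v = lexLeq u v ≡ true

≡ᵇ-refl : ∀ n → (n ≡ᵇ n) ≡ true
≡ᵇ-refl n = T⇒≡true (ℕ.≡⇒≡ᵇ n n refl)

<ᵇ-irrefl : ∀ n → (n <ᵇ n) ≡ false
<ᵇ-irrefl zero    = refl
<ᵇ-irrefl (suc n) = <ᵇ-irrefl n

≼-< : ∀ {k} {x y : Fin k} xs ys → toℕ x < toℕ y → x ∷ xs ≼ y ∷ ys
≼-< _ _ x<y rewrite T⇒≡true (ℕ.<⇒<ᵇ x<y) = refl

≼-∷ : ∀ {k} (x : Fin k) xs ys → xs ≼ ys → x ∷ xs ≼ x ∷ ys
≼-∷ x xs ys p rewrite <ᵇ-irrefl (toℕ x) | ≡ᵇ-refl (toℕ x) = p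

≼-∷⁻ : ∀ {k} (x y : Fin k) xs ys → x ∷ xs ≼ y ∷ ys → toℕ x < toℕ y ⊎ (x ≡ y × xs ≼ ys)
≼-∷⁻ x y xs ys p with toℕ x <ᵇ toℕ y in lt
... | true = inj₁ (ℕ.<ᵇ⇒< _ _ (≡true⇒T lt))
... | false with toℕ x ≡ᵇ toℕ y in eq
... | true = inj₂ (Fin.toℕ-injective (ℕ.≡ᵇ⇒≡ _ _ (≡true⇒T eq)) , p)

≼-refl : ∀ {k} (u : Word k) → u ≼ u
≼-refl []      = refl
≼-refl (x ∷ u) = ≼-∷ x u u (≼-refl u)

≼-trans : ∀ {k} (u v w : Word k) → u ≼ v → v ≼ w → u ≼ w
≼-trans [] v w _ _ = refl
≼-trans (x ∷ u) (y ∷ v) (z ∷ w) p q with ≼-∷⁻ x y u v p | ≼-∷⁻ y z v w q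
... | inj₁ x<y         | inj₁ y<z         = ≼-< u w (ℕ.<-trans x<y y<z)
... | inj₁ x<y         | inj₂ (refl , _)  = ≼-< u w x<y
... | inj₂ (refl , _)  | inj₁ y<z         = ≼-< u w y<z
... | inj₂ (refl , p′) | inj₂ (refl , q′) = ≼-∷ x u w (≼-trans u v w p′ q′)

≼-antisym : ∀ {k} (u v : Word k) → u ≼ v → v ≼ u → u ≡ v
≼-antisym [] [] _ _ = refl
≼-antisym (x ∷ u) (y ∷ v) p q with ≼-∷⁻ x y u v p | ≼-∷⁻ y x v u q
... | inj₁ x<y         | inj₁ y<x         = contradiction y<x (ℕ.<-asym x<y)
... | inj₁ x<y         | inj₂ (refl , _)  = contradiction x<y (ℕ.<-irrefl refl)
... | inj₂ (refl , _)  | inj₁ y<x         = contradiction y<x (ℕ.<-irrefl refl)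
... | inj₂ (refl , p′) | inj₂ (_ , q′)    = cong (x ∷_) (≼-antisym u v p′ q′)

≼-total : ∀ {k} (u v : Word k) → u ≼ v ⊎ v ≼ u
≼-total [] v = inj₁ refl
≼-total (x ∷ u) [] = inj₂ refl
≼-total (x ∷ u) (y ∷ v) with Fin.<-cmp x y
... | tri< x<y _ _ = inj₁ (≼-< u v x<y)
... | tri> _ _ y<x = inj₂ (≼-< v u y<x)
... | tri≈ _ refl _ with ≼-total u v
... | inj₁ p = inj₁ (≼-∷ x u v p)
... | inj₂ p = inj₂ (≼-∷ x v u p)

insertLex-↭ : ∀ {k} (u : Word k) vs → insertLex u vs ↭ u ∷ vs
insertLex-↭ u [] = ↭-refl
insertLex-↭ u (v ∷ vs) with lexLeq u v
... | true  = ↭-refl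
... | false = ↭-trans (prep v (insertLex-↭ u vs)) (swap v u ↭-refl)

sortLex-↭ : ∀ {k} (us : List (Word k)) → sortLex us ↭ us
sortLex-↭ []       = ↭-refl
sortLex-↭ (u ∷ us) = ↭-trans (insertLex-↭ u (sortLex us)) (prep u (sortLex-↭ us))

insertLex-sorted : ∀ {k} (u : Word k) vs → AllPairs _≼_ vs → AllPairs _≼_ (insertLex u vs)
insertLex-sorted u [] _ = [] ∷ []
insertLex-sorted u (v ∷ vs) (pv ∷ pvs) with lexLeq u v in eq
... | true = (eq ∷ All.map (λ {w} → ≼-trans u v w eq) pv) ∷ pv ∷ pvs
... | false = ↭.All-resp-↭ (↭-sym (insertLex-↭ u vs)) (v≼u ∷ pv) ∷ insertLex-sorted u vs pvs
  where
  v≼u : v ≼ u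
  v≼u with ≼-total u v
  ... | inj₂ p = p
  ... | inj₁ p with trans (sym eq) p
  ... | ()

sortLex-sorted : ∀ {k} (us : List (Word k)) → AllPairs _≼_ (sortLex us)
sortLex-sorted []       = []
sortLex-sorted (u ∷ us) = insertLex-sorted u (sortLex us) (sortLex-sorted us)

-- Each head occurs in the other list, so the heads bound each other and agree by antisymmetry, even
-- when entries repeat. This identifies a Burrows-Wheeler matrix from any sorted arrangement of the
-- rotations.
sorted-unique : ∀ {k} {us vs : List (Word k)} → AllPairs _≼_ us → AllPairs _≼_ vs → us ↭ vs → us ≡ vs
sorted-unique {us = []} _ _ p = sym (↭.↭-empty-inv (↭-sym p))
sorted-unique {us = u ∷ us} {[]} _ _ p = contradiction p ↭.¬x∷xs↭[]
sorted-unique {us = u ∷ us} {v ∷ vs} (pu ∷ pus) (pv ∷ pvs) p with u≡v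
  where
  first : ∀ {k} {u v : Word k} {vs} → All (v ≼_) vs → u ∈ v ∷ vs → v ≼ u
  first {v = v} _ (here refl) = ≼-refl v
  first pv (there q) = All.lookup pv q
  u≡v : u ≡ v
  u≡v = ≼-antisym u v (first pu (↭.∈-resp-↭ (↭-sym p) (here refl))) (first pv (↭.∈-resp-↭ p (here refl)))
... | refl = cong (u ∷_) (sorted-unique pus pvs (↭.drop-∷ p))

-- Rotations

iter-rot1-++ : ∀ {A : Set} (xs ys : List A) → iter (length xs) rot1 (xs ++ ys) ≡ ys ++ xs
iter-rot1-++ [] ys = sym (List.++-identityʳ ys)
iter-rot1-++ (x ∷ xs) ys = begin
  rot1 (iter (length xs) rot1 (x ∷ xs ++ ys))     ≡⟨ iter-shift (length xs) rot1 (x ∷ xs ++ ys) ⟨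
  iter (length xs) rot1 ((xs ++ ys) ++ [ x ])     ≡⟨ cong (iter (length xs) rot1) (List.++-assoc xs ys [ x ]) ⟩
  iter (length xs) rot1 (xs ++ (ys ++ [ x ]))     ≡⟨ iter-rot1-++ xs (ys ++ [ x ]) ⟩
  (ys ++ [ x ]) ++ xs                             ≡⟨ List.++-assoc ys [ x ] xs ⟩
  ys ++ x ∷ xs                                    ∎
  where open ≡-Reasoning

iter-length-rot1 : ∀ {A : Set} (w : List A) → iter (length w) rot1 w ≡ w
iter-length-rot1 w = subst (λ v → iter (length w) rot1 v ≡ w) (List.++-identityʳ w) (iter-rot1-++ w [])

map-rot1-rotationsN : ∀ {A : Set} i (w : List A) → map rot1 (rotationsN i w) ≡ rotationsN i (rot1 w)
map-rot1-rotationsN zero    w = refl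
map-rot1-rotationsN (suc i) w = cong (rot1 w ∷_) (map-rot1-rotationsN i (rot1 w))

rotationsN-∷ʳ : ∀ {A : Set} i (w : List A) → rotationsN (suc i) w ≡ rotationsN i w ∷ʳ iter i rot1 w
rotationsN-∷ʳ zero    w = refl
rotationsN-∷ʳ (suc i) w = cong (w ∷_)
  (trans (rotationsN-∷ʳ i (rot1 w)) (cong (rotationsN i (rot1 w) ∷ʳ_) (iter-shift i rot1 w)))

-- One rotation past the end leads back to `w`, so rotating every entry only moves the list on
-- cyclically. Multiplicities are kept, which matters while the word may still be imprimitive.
map-rot1-rotations : ∀ {A : Set} (w : List A) → map rot1 (rotations w) ↭ rotations w
map-rot1-rotations w = ↭.drop-∷ (subst (_↭ w ∷ rotations w) (sym eq) (↭-sym (↭.∷↭∷ʳ w (rotations w))))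
  where
  eq : w ∷ map rot1 (rotations w) ≡ rotations w ∷ʳ w
  eq = trans (cong (w ∷_) (map-rot1-rotationsN (length w) w))
    (trans (rotationsN-∷ʳ (length w) w) (cong (rotations w ∷ʳ_) (iter-length-rot1 w)))

length-rotationsN : ∀ {A : Set} i (w : List A) → length (rotationsN i w) ≡ i
length-rotationsN zero    w = refl
length-rotationsN (suc i) w = cong suc (length-rotationsN i (rot1 w))

∈-rotationsN⁻ : ∀ {A : Set} i {u w : List A} → u ∈ rotationsN i w → ∃[ t ] t < i × u ≡ iter t rot1 w
∈-rotationsN⁻ (suc i) (here refl) = 0 , s≤s z≤n , refl
∈-rotationsN⁻ (suc i) {w = w} (there p) with ∈-rotationsN⁻ i p
... | t , t<i , eq = suc t , s≤s t<i , trans eq (iter-shift t rot1 w)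

-- The suffix `ys` makes the induction work: it collects the letters already rotated to the back,
-- while the heads still to come are those of `xs`.
map-head-rotationsN : ∀ {A : Set} (xs ys : List A) → map head (rotationsN (length xs) (xs ++ ys)) ≡ map just xs
map-head-rotationsN [] ys = refl
map-head-rotationsN (x ∷ xs) ys = cong (just x ∷_)
  (trans (cong (λ w → map head (rotationsN (length xs) w)) (List.++-assoc xs ys [ x ]))
         (map-head-rotationsN xs (ys ++ [ x ])))

map-head-rotations : ∀ {A : Set} (w : List A) → map head (rotations w) ≡ map just w
map-head-rotations w =
  subst (λ v → map head (rotationsN (length w) v) ≡ map just w) (List.++-identityʳ w) (map-head-rotationsN w [])

map-rot1 : ∀ {A B : Set} (f : A → B) w → map f (rot1 w) ≡ rot1 (map f w)
map-rot1 f []      = refl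
map-rot1 f (x ∷ w) = List.map-++ f w [ x ]

map-rotations : ∀ {A B : Set} (f : A → B) w → map (map f) (rotations w) ≡ rotations (map f w)
map-rotations f w = trans (go (length w) w) (cong (λ i → rotationsN i (map f w)) (sym (List.length-map f w)))
  where
  go : ∀ i w → map (map f) (rotationsN i w) ≡ rotationsN i (map f w)
  go zero    w = refl
  go (suc i) w = cong (map f w ∷_) (trans (go i (rot1 w)) (cong (rotationsN i) (map-rot1 f w)))

length-rot1 : ∀ {A : Set} (w : List A) → length (rot1 w) ≡ length w
length-rot1 []      = refl
length-rot1 (x ∷ w) = trans (List.length-++ w) (ℕ.+-comm (length w) 1)

last-∷ʳ : ∀ {A : Set} (xs : List A) x → last (xs ∷ʳ x) ≡ just x
last-∷ʳ []           x = refl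
last-∷ʳ (y ∷ [])     x = refl
last-∷ʳ (y ∷ z ∷ xs) x = last-∷ʳ (z ∷ xs) x

last-rot1 : ∀ {A : Set} (w : List A) → last (rot1 w) ≡ head w
last-rot1 []      = refl
last-rot1 (x ∷ w) = last-∷ʳ w x

-- Permutation words and blocks

countLetter-∉ : ∀ {k} (a : Fin k) {u} → a ∉ u → countLetter a u ≡ 0
countLetter-∉ a {[]} _ = refl
countLetter-∉ a {x ∷ u} a∉ with toℕ a ≡ᵇ toℕ x in eq
... | true  = contradiction (here (Fin.toℕ-injective (ℕ.≡ᵇ⇒≡ _ _ (≡true⇒T eq)))) a∉
... | false = countLetter-∉ a (a∉ ∘ there)

countLetter-Unique : ∀ {k} (a : Fin k) {u} → Unique u → a ∈ u → countLetter a u ≡ 1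
countLetter-Unique a (pa ∷ uu) (here refl) rewrite ≡ᵇ-refl (toℕ a) =
  cong suc (countLetter-∉ a (Unique-head (pa ∷ uu)))
countLetter-Unique a {x ∷ u} (px ∷ uu) (there a∈) with toℕ a ≡ᵇ toℕ x in eq
... | false = countLetter-Unique a uu a∈
... | true with Fin.toℕ-injective {i = a} {x} (ℕ.≡ᵇ⇒≡ _ _ (≡true⇒T eq))
... | refl = contradiction a∈ (Unique-head (px ∷ uu))

countLetter⇒∈ : ∀ {k} (a : Fin k) u → countLetter a u ≡ 1 → a ∈ u
countLetter⇒∈ a (x ∷ u) eq with toℕ a ≡ᵇ toℕ x in a≡x
... | true  = here (Fin.toℕ-injective (ℕ.≡ᵇ⇒≡ _ _ (≡true⇒T a≡x)))
... | false = there (countLetter⇒∈ a u eq)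

isPermWord⁺ : ∀ {k} (f : Fin k → Fin k) → (∀ {i j} → f i ≡ f j → i ≡ j) → isPermWord k (tabulate f) ≡ true
isPermWord⁺ {k} f inj = allᵇ⁺ _ (allFin k) λ a _ → cong (_≡ᵇ 1)
  (countLetter-Unique a (Unique.tabulate⁺ inj) (long-Unique⇒∈ (Unique.tabulate⁺ inj) (List.length-tabulate f) a))

isPermWord⁻ : ∀ {k} (f : Fin k → Fin k) → isPermWord k (tabulate f) ≡ true → ∀ a → ∃[ i ] f i ≡ a
isPermWord⁻ {k} f p a with ∈.∈-tabulate⁻ (countLetter⇒∈ a (tabulate f)
  (ℕ.≡ᵇ⇒≡ _ _ (≡true⇒T (allᵇ⁻ (λ a → countLetter a (tabulate f) ≡ᵇ 1) (allFin k) p (∈.∈-allFin a)))))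
... | i , eq = i , sym eq

take-tabulate : ∀ {A : Set} k {r} (f : Fin (k + r) → A) → take k (tabulate f) ≡ tabulate (λ i → f (i ↑ˡ r))
take-tabulate zero    f = refl
take-tabulate (suc k) f = cong (f fzero ∷_) (take-tabulate k (f ∘ fsuc))

drop-tabulate : ∀ {A : Set} k {r} (f : Fin (k + r) → A) → drop k (tabulate f) ≡ tabulate (λ i → f (k ↑ʳ i))
drop-tabulate zero    f = refl
drop-tabulate (suc k) f = drop-tabulate k (f ∘ fsuc)

isPermConcatF-tabulate : ∀ k fuel {r} (U : Fin (suc k + r) → Fin (suc k)) →
  isPermConcatF (suc k) (suc fuel) (tabulate U) ≡
  isPermWord (suc k) (tabulate (λ i → U (i ↑ˡ r))) ∧ isPermConcatF (suc k) fuel (tabulate (λ i → U (suc k ↑ʳ i)))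
isPermConcatF-tabulate k fuel U = cong₂ (λ block rest → isPermWord (suc k) block ∧ isPermConcatF (suc k) fuel rest)
  (take-tabulate (suc k) U) (drop-tabulate (suc k) U)

-- `combine m i` is place `i` of block `m`. The fuel is bounded only from below, because
-- `isPermConcat` supplies the length of the word instead of its number of blocks.
isPermConcatF⁺ : ∀ k fuel n (U : Fin (n * suc k) → Fin (suc k)) → n ≤ fuel →
  (∀ m {i j} → U (combine {n} m i) ≡ U (combine m j) → i ≡ j) → isPermConcatF (suc k) fuel (tabulate U) ≡ true
isPermConcatF⁺ k zero       zero    U _ _ = refl
isPermConcatF⁺ k (suc fuel) zero    U _ _ = refl
isPermConcatF⁺ k (suc fuel) (suc n) U (s≤s n≤) inj = trans (isPermConcatF-tabulate k fuel U)
  (cong₂ _∧_ (isPermWord⁺ (λ i → U (i ↑ˡ (n * suc k))) (inj fzero))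
             (isPermConcatF⁺ k fuel n (λ i → U (suc k ↑ʳ i)) n≤ (λ m → inj (fsuc m))))

isPermConcatF⁻ : ∀ k fuel n (U : Fin (n * suc k) → Fin (suc k)) → n ≤ fuel →
  isPermConcatF (suc k) fuel (tabulate U) ≡ true → ∀ (m : Fin n) a → ∃[ i ] U (combine m i) ≡ a
isPermConcatF⁻ k (suc fuel) (suc n) U (s≤s n≤) p m a with ∧-true⁻ (trans (sym (isPermConcatF-tabulate k fuel U)) p) | m
... | block , _ | fzero   = isPermWord⁻ (λ i → U (i ↑ˡ (n * suc k))) block a
... | _ , rest | fsuc m′ = isPermConcatF⁻ k fuel n (λ i → U (suc k ↑ʳ i)) n≤ rest m′ a

-- Used with `↭-map-inv` to reindex a list once its image under `f` has been permuted: rotations by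
-- their first edge, with `f` equal to `head`, and preimages of the rows, with `f` equal to `rot1`.
map≡tabulate : ∀ {A B : Set} (f : A → B) {n} (xs : List A) {g : Fin n → B} → map f xs ≡ tabulate g →
  Σ (Fin n → A) λ h → xs ≡ tabulate h × (∀ i → f (h i) ≡ g i)
map≡tabulate f {zero}  []       _  = (λ ()) , refl , λ ()
map≡tabulate f {suc n} (x ∷ xs) eq with map≡tabulate f xs (List.∷-injectiveʳ eq)
... | h , refl , hyp = (λ { fzero → x ; (fsuc i) → h i }) , refl , λ { fzero → List.∷-injectiveˡ eq ; (fsuc i) → hyp i }

tabulate-of-length : ∀ {A : Set} {n} (xs : List A) → length xs ≡ n → Σ (Fin n → A) λ f → xs ≡ tabulate f
tabulate-of-length xs refl = _ , sym (List.tabulate-lookup xs)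

mapMaybe-tabulate : ∀ {A B : Set} (g : A → Maybe B) {n} (f : Fin n → A) (h : Fin n → B) → (∀ i → g (f i) ≡ just (h i)) →
  mapMaybe g (tabulate f) ≡ tabulate h
mapMaybe-tabulate g {n = zero} f h eq = refl
mapMaybe-tabulate g {n = suc n} f h eq rewrite eq fzero =
  cong (h fzero ∷_) (mapMaybe-tabulate g (f ∘ fsuc) (h ∘ fsuc) (eq ∘ fsuc))

tabulate-cast : ∀ {A : Set} {a b} (p : b ≡ a) (f : Fin a → A) → tabulate f ≡ tabulate (λ i → f (cast p i))
tabulate-cast refl f = List.tabulate-cong (λ i → cong f (sym (Fin.cast-is-id refl i)))

≼-∷-≡ : ∀ {k} {x y : Fin k} xs ys → x ≡ y → xs ≼ ys → x ∷ xs ≼ y ∷ ys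
≼-∷-≡ {x = x} xs ys refl p = ≼-∷ x xs ys p

-- From tours to words

module Words (k m : ℕ) where
  open EulerTours k m

  N : ℕ
  N = suc k * suc m

  N′≡N : suc m * suc k ≡ N
  N′≡N = ℕ.*-comm (suc m) (suc k)

  good : Word (suc k) → Bool
  good w = isNecklaceRep w ∧ isGenDeBruijn (suc k) w

  root : Edge
  root = edge fzero fzero

  toℕ-root : toℕ root ≡ 0
  toℕ-root = trans (toℕ-edge fzero fzero) (trans (ℕ.+-identityʳ _) (ℕ.*-zeroʳ k))

  root-least : ∀ q → root ≡ q ⊎ toℕ root < toℕ q
  root-least q with toℕ q in eq
  ... | zero    = inj₁ (Fin.toℕ-injective (trans toℕ-root (sym eq)))
  ... | suc _   = inj₂ (subst (_< _) (sym toℕ-root) (s≤s z≤n))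

  -- As a position in the transform, `edge v i` is place `i` of block `v`, so the blocks belong to
  -- the vertices. The cast only exchanges the two factors of `N`.
  isPermConcat-tabulate⁺ : (U : Edge → Fin (suc k)) → (∀ v {i j} → U (edge v i) ≡ U (edge v j) → i ≡ j) →
    isPermConcat (suc k) (tabulate U) ≡ true
  isPermConcat-tabulate⁺ U inj =
    subst₂ (λ l u → isPermConcatF (suc k) l u ≡ true) (sym (List.length-tabulate U)) (sym (tabulate-cast N′≡N U))
      (isPermConcatF⁺ k N (suc m) (λ i → U (cast N′≡N i)) (ℕ.m≤m+n (suc m) _) inj′)
    where
    inj′ : ∀ v {i j} → U (cast N′≡N (combine {suc m} v i)) ≡ U (cast N′≡N (combine v j)) → i ≡ j
    inj′ v {i} {j} eq = inj v (subst₂ (λ e f → U e ≡ U f) (cast-combine v i) (cast-combine v j) eq)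

  isPermConcat-tabulate⁻ : (U : Edge → Fin (suc k)) → isPermConcat (suc k) (tabulate U) ≡ true →
    ∀ v a → ∃[ i ] U (edge v i) ≡ a
  isPermConcat-tabulate⁻ U p v a
    with isPermConcatF⁻ k N (suc m) (λ i → U (cast N′≡N i)) (ℕ.m≤m+n (suc m) _)
      (subst₂ (λ l u → isPermConcatF (suc k) l u ≡ true) (List.length-tabulate U) (tabulate-cast N′≡N U) p) v a
  ... | i , eq = i , trans (cong U (sym (cast-combine v i))) eq

  walk-∷ʳ : ∀ {v w es e} → Walk v es w → source e ≡ w → Walk v (es ∷ʳ e) (target e)
  walk-∷ʳ nil        eq = step eq nil
  walk-∷ʳ (step s W) eq = step s (walk-∷ʳ W eq)

  walk-end : ∀ {v w} es {e} → Walk v (es ∷ʳ e) w → target e ≡ w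
  walk-end []       (step _ nil) = refl
  walk-end (_ ∷ es) (step _ W)   = walk-end es W

  walk-start : ∀ {v w es e} → Walk v es w → head es ≡ just e → source e ≡ v
  walk-start (step s W) refl = s

  walk-start-unique : ∀ {v v′ w es} → Walk v es w → Walk v′ es w → v ≡ v′
  walk-start-unique nil nil = refl
  walk-start-unique (step s _) (step s′ _) = trans (sym s) s′

  -- Read backwards: the letter and the target of an edge determine it, hence its source.
  letters-determine-walk : ∀ {v v′ w es fs} → Walk v es w → Walk v′ fs w → map letter es ≡ map letter fs → es ≡ fs
  letters-determine-walk nil nil _ = refl
  letters-determine-walk (step {e = e} _ W) (step {e = f} _ W′) eq
    with letters-determine-walk W W′ (List.∷-injectiveʳ eq)
  ... | refl = cong (_∷ _) (trans (sym (edgeInto-η e))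
    (trans (cong₂ edgeInto (walk-start-unique W W′) (List.∷-injectiveˡ eq)) (edgeInto-η f)))

  -- If the first letters tie, the targets are still in order. They are the sources of the next
  -- edges, and a smaller source means a smaller edge, so the tails compare in the same way.
  walk-≼ : ∀ {v x w y} e us f vs → Walk v (e ∷ us) x → Walk w (f ∷ vs) y → length us ≡ length vs → toℕ e < toℕ f →
    map letter (e ∷ us) ≼ map letter (f ∷ vs)
  walk-≼ e us f vs V W l e<f with <⇒letter-or-target-< {e} {f} e<f
  ... | inj₁ a<b = ≼-< (map letter us) (map letter vs) a<b
  walk-≼ e [] f vs V W l e<f | inj₂ (a≡b , t<t) = ≼-∷-≡ [] (map letter vs) a≡b refl
  walk-≼ e (e′ ∷ us) f (f′ ∷ vs) (step _ V@(step s _)) (step _ W@(step s′ _)) l e<f | inj₂ (a≡b , t<t) =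
    ≼-∷-≡ (map letter (e′ ∷ us)) (map letter (f′ ∷ vs)) a≡b
      (walk-≼ e′ us f′ vs V W (ℕ.suc-injective l) (source-mono {e′} {f′} (subst₂ (λ a b → toℕ a < toℕ b) (sym s) (sym s′) t<t)))

  closed-walk-rotations : ∀ i {v es} → Walk v es v → ∀ {u} → u ∈ rotationsN i es → (∃[ v ] Walk v u v) × length u ≡ length es
  closed-walk-rotations (suc i) W (here refl) = (_ , W) , refl
  closed-walk-rotations (suc i) {v} nil (there p) = closed-walk-rotations i (nil {v}) p
  closed-walk-rotations (suc i) (step {e = e} {es} s W) (there p) with closed-walk-rotations i (walk-∷ʳ W s) p
  ... | W′ , l = W′ , trans l (length-rot1 (e ∷ es))

  module TourWord {es} (tour : Tour es) where
    open Tour tour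

    w : Word (suc k)
    w = map letter es

    -- The rotations of a tour begin with its successive edges, hence with each edge exactly once.
    -- Indexing them by this first edge gives the candidate for the sorted matrix.
    ordered : Σ (Edge → List Edge) λ ρ → rotations es ↭ tabulate ρ × (∀ q → head (ρ q) ≡ just q)
    ordered with ↭.↭-map-inv head (subst (_↭ map just (allFin N)) (sym (map-head-rotations es)) (↭.map⁺ just covers))
    ... | Q , eq , p with map≡tabulate head Q {just} (trans (sym eq) (List.map-tabulate id just))
    ... | ρ , refl , heads = ρ , p , heads

    ρ : Edge → List Edge
    ρ = proj₁ ordered

    rotations-ρ : rotations es ↭ tabulate ρ
    rotations-ρ = proj₁ (proj₂ ordered)

    head-ρ : ∀ q → head (ρ q) ≡ just q
    head-ρ = proj₂ (proj₂ ordered)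

    ρ-rotation : ∀ q → ρ q ∈ rotations es
    ρ-rotation q = ↭.∈-resp-↭ (↭-sym rotations-ρ) (∈.∈-tabulate⁺ {f = ρ} q)

    ρ-walk : ∀ q → ∃[ v ] Walk v (ρ q) v
    ρ-walk q = proj₁ (closed-walk-rotations (length es) closed (ρ-rotation q))

    row : Edge → Word (suc k)
    row q = map letter (ρ q)

    row-≼ : ∀ {p q} → toℕ p < toℕ q → row p ≼ row q
    row-≼ {p} {q} p<q = go (ρ p) (ρ q) (head-ρ p) (head-ρ q) (proj₂ (ρ-walk p)) (proj₂ (ρ-walk q))
      (trans (proj₂ (closed-walk-rotations (length es) closed (ρ-rotation p)))
             (sym (proj₂ (closed-walk-rotations (length es) closed (ρ-rotation q)))))
      where
      go : ∀ us vs {v x w y} → head us ≡ just p → head vs ≡ just q → Walk v us x → Walk w vs y → length us ≡ length vs →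
        map letter us ≼ map letter vs
      go (e ∷ us) (f ∷ vs) refl refl V W l = walk-≼ e us f vs V W (ℕ.suc-injective l) p<q

    rotations-w : rotations w ↭ tabulate row
    rotations-w = subst₂ _↭_ (map-rotations letter es) (List.map-tabulate ρ (map letter)) (↭.map⁺ (map letter) rotations-ρ)

    bwMatrix-w : bwMatrix w ≡ tabulate row
    bwMatrix-w = sorted-unique (sortLex-sorted (rotations w)) (AllPairs.tabulate⁺-< {f = row} row-≼)
      (↭-trans (sortLex-↭ (rotations w)) rotations-w)

    predecessor : ∀ q → ∃[ p ] last (ρ q) ≡ just p × target p ≡ source q
    predecessor q with ρ q | head-ρ q | ρ-walk q
    ... | us | h | v , W with initLast us
    predecessor q | .[] | () | v , W | []
    ... | us′ ∷ʳ′ p = p , last-∷ʳ us′ p , trans (walk-end us′ W) (sym (walk-start W h))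

    pred : Edge → Edge
    pred q = proj₁ (predecessor q)

    -- Rotating all rotations permutes them, and the last edge of a rotated list is the head of the
    -- original. The last edges therefore run over every edge once, as the first edges do.
    lasts : tabulate (just ∘ pred) ↭ map just (allFin N)
    lasts = subst₂ _↭_ (trans (List.map-tabulate ρ last) (List.tabulate-cong (λ q → proj₁ (proj₂ (predecessor q))))) refl
      (↭-trans (↭.map⁺ last (↭-trans (↭-sym rotations-ρ) (↭-sym (map-rot1-rotations es))))
        (subst (_↭ map just (allFin N)) (sym firsts) (↭.map⁺ just covers)))
      where
      firsts : map last (map rot1 (rotations es)) ≡ map just es
      firsts = trans (sym (List.map-∘ (rotations es))) (trans (List.map-cong last-rot1 (rotations es)) (map-head-rotations es))

    pred-injective : ∀ {p q} → pred p ≡ pred q → p ≡ q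
    pred-injective = surjective⇒injective λ e → onto e (↭.∈-resp-↭ (↭-sym lasts) (∈.∈-map⁺ just (∈.∈-allFin e)))
      where
      onto : ∀ e → just e ∈ tabulate (just ∘ pred) → ∃[ q ] pred q ≡ e
      onto e p with ∈.∈-tabulate⁻ p
      ... | q , eq = q , sym (Maybe.just-injective eq)

    bwt-w : bwt w ≡ tabulate (letter ∘ pred)
    bwt-w = trans (cong (mapMaybe last) bwMatrix-w) (mapMaybe-tabulate last row (letter ∘ pred) lasts-letter)
      where
      last-map : ∀ es {e} → last es ≡ just e → last (map letter es) ≡ just (letter e)
      last-map (_ ∷ [])      refl = refl
      last-map (_ ∷ f ∷ es) eq   = last-map (f ∷ es) eq
      lasts-letter : ∀ q → last (row q) ≡ just (letter (pred q))
      lasts-letter q = last-map (ρ q) (proj₁ (proj₂ (predecessor q)))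

    -- The predecessors of the edges in block v all have target v. Two equal letters in this block
    -- would make two predecessors equal, and `pred` is injective.
    deBruijn : isGenDeBruijn (suc k) w ≡ true
    deBruijn = subst (λ u → isPermConcat (suc k) u ≡ true) (sym bwt-w) (isPermConcat-tabulate⁺ (letter ∘ pred) distinct)
      where
      target-pred : ∀ v i → target (pred (edge v i)) ≡ v
      target-pred v i = trans (proj₂ (proj₂ (predecessor (edge v i)))) (source-edge v i)
      distinct : ∀ v {i j} → letter (pred (edge v i)) ≡ letter (pred (edge v j)) → i ≡ j
      distinct v {i} {j} eq = trans (sym (label-edge v i)) (trans (cong label (pred-injective
        (trans (sym (edgeInto-η _)) (trans (cong₂ edgeInto (trans (target-pred v i) (sym (target-pred v j))) eq) (edgeInto-η _)))))
        (label-edge v j))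

    -- The tour starts with the least edge, so it is `ρ root` and `w` is the top row.
    necklace : isNecklaceRep w ≡ true
    necklace = allᵇ⁺ (lexLeq w) (rotations w) λ u u∈ → least u (∈.∈-tabulate⁻ {f = row} (↭.∈-resp-↭ rotations-w u∈))
      where
      es∈rotations : es ∈ rotations es
      es∈rotations with starts
      ... | _ , refl = here refl
      es≡ : es ≡ ρ root
      es≡ with ∈.∈-tabulate⁻ {f = ρ} (↭.∈-resp-↭ rotations-ρ es∈rotations) | starts
      ... | q , es≡ρq | _ , eq =
        trans es≡ρq (cong ρ (Maybe.just-injective (trans (sym (head-ρ q)) (trans (cong head (sym es≡ρq)) (cong head eq)))))
      least : ∀ u → ∃[ q ] u ≡ row q → w ≼ u
      least u (q , refl) = subst (_≼ row q) (sym (cong (map letter) es≡)) (row-root-≼ (root-least q))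
        where
        row-root-≼ : root ≡ q ⊎ toℕ root < toℕ q → row root ≼ row q
        row-root-≼ (inj₁ refl) = ≼-refl (row root)
        row-root-≼ (inj₂ lt)   = row-≼ lt

    tour⇒good : good w ≡ true
    tour⇒good = cong₂ _∧_ necklace deBruijn

-- From words to tours: inverting the transform

∷ʳ-≼⁻ : ∀ {k} (us vs : Word k) {a b} → length us ≡ length vs → us ∷ʳ a ≼ vs ∷ʳ b → us ≼ vs
∷ʳ-≼⁻ []       vs       _ _ = refl
∷ʳ-≼⁻ (x ∷ us) (y ∷ vs) {a} {b} l p with ≼-∷⁻ x y (us ∷ʳ a) (vs ∷ʳ b) p
... | inj₁ x<y      = ≼-< us vs x<y
... | inj₂ (eq , q) = ≼-∷-≡ us vs eq (∷ʳ-≼⁻ us vs (ℕ.suc-injective l) q)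

length-iter-rot1 : ∀ {A : Set} t (w : List A) → length (iter t rot1 w) ≡ length w
length-iter-rot1 zero    w = refl
length-iter-rot1 (suc t) w = trans (length-rot1 (iter t rot1 w)) (length-iter-rot1 t w)

iter-injective : ∀ {A : Set} {f : A → A} → (∀ {x y} → f x ≡ f y → x ≡ y) → ∀ t {x y} → iter t f x ≡ iter t f y → x ≡ y
iter-injective inj zero    eq = eq
iter-injective inj (suc t) eq = iter-injective inj t (inj eq)

-- Two letters are needed: the rows of an imprimitive word repeat, which would put two equal letters into the first block.
module WordTour (k m : ℕ) (w : Word (suc (suc k))) (length-w : length w ≡ suc (suc k) * suc m)
  (good-w : Words.good (suc k) m w ≡ true) where
  open EulerTours (suc k) m
  open Words (suc k) m

  Label : Set
  Label = Fin (suc (suc k))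

  opaque
    sorted-rows : Σ (Edge → Word (suc (suc k))) λ row → bwMatrix w ≡ tabulate row
    sorted-rows = tabulate-of-length (bwMatrix w)
      (trans (↭.↭-length (sortLex-↭ (rotations w))) (trans (length-rotationsN (length w) w) length-w))

  row : Edge → Word (suc (suc k))
  row = proj₁ sorted-rows

  rows↭rotations : tabulate row ↭ rotations w
  rows↭rotations = subst (_↭ rotations w) (proj₂ sorted-rows) (sortLex-↭ (rotations w))

  row-rotation : ∀ q → ∃[ t ] t < length w × row q ≡ iter t rot1 w
  row-rotation q = ∈-rotationsN⁻ (length w) (↭.∈-resp-↭ rows↭rotations (∈.∈-tabulate⁺ {f = row} q))

  length-row : ∀ q → length (row q) ≡ length w
  length-row q with row-rotation q
  ... | t , _ , eq = trans (cong length eq) (length-iter-rot1 t w)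

  row-mono : ∀ {p q} → toℕ p < toℕ q → row p ≼ row q
  row-mono {p} {q} = sorted-lookup {f = row} (subst (AllPairs _≼_) (proj₂ sorted-rows) (sortLex-sorted (rotations w)))
    where
    sorted-lookup : ∀ {n} {f : Fin n → Word (suc (suc k))} → AllPairs _≼_ (tabulate f) →
      ∀ {p q} → toℕ p < toℕ q → f p ≼ f q
    sorted-lookup {suc n} {f} (pf ∷ _) {fzero}  {fsuc q} _         = All.tabulate⁻ pf q
    sorted-lookup {suc n} {f} (_ ∷ s)  {fsuc p} {fsuc q} (s≤s p<q) = sorted-lookup {f = f ∘ fsuc} s p<q

  opaque
    -- `row° q` is `row q` with its last letter moved to the front. Inverting `rot1` on the whole
    -- list of rotations shows at once that these words are the rows again, with multiplicity.
    unrotated : Σ (Edge → Word (suc (suc k))) λ r → tabulate r ↭ tabulate row × (∀ q → rot1 (r q) ≡ row q)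
    unrotated with ↭.↭-map-inv rot1 (↭-trans (↭.map⁺ rot1 rows↭rotations) (↭-trans (map-rot1-rotations w) (↭-sym rows↭rotations)))
    ... | ys , eq , p with map≡tabulate rot1 ys {row} (sym eq)
    ... | r , refl , rot = r , ↭-sym p , rot

  row° : Edge → Word (suc (suc k))
  row° = proj₁ unrotated

  row°↭row : tabulate row° ↭ tabulate row
  row°↭row = proj₁ (proj₂ unrotated)

  rot1-row° : ∀ q → rot1 (row° q) ≡ row q
  rot1-row° = proj₂ (proj₂ unrotated)

  opaque
    uncons-row° : ∀ q → ∃₂ λ a u → row° q ≡ a ∷ u × row q ≡ u ∷ʳ a
    uncons-row° q with row° q | rot1-row° q
    ... | a ∷ u | eq = a , u , refl , sym eq
    ... | []    | eq with trans (cong length eq) (trans (length-row q) length-w)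
    ... | ()

  final : Edge → Label
  final q = proj₁ (uncons-row° q)

  init : Edge → Word (suc (suc k))
  init q = proj₁ (proj₂ (uncons-row° q))

  row°≡ : ∀ q → row° q ≡ final q ∷ init q
  row°≡ q = proj₁ (proj₂ (proj₂ (uncons-row° q)))

  row≡ : ∀ q → row q ≡ init q ∷ʳ final q
  row≡ q = proj₂ (proj₂ (proj₂ (uncons-row° q)))

  bwt≡ : bwt w ≡ tabulate final
  bwt≡ = trans (cong (mapMaybe last) (proj₂ sorted-rows))
    (mapMaybe-tabulate last row final (λ q → trans (cong last (row≡ q)) (last-∷ʳ (init q) (final q))))

  opaque
    -- Block v of the transform consists of the final letters of the rows `edge v i`. As a
    -- permutation word it contains every letter, in particular the one that `next` looks for.
    final-onto : ∀ v a → ∃[ i ] final (edge v i) ≡ a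
    final-onto = isPermConcat-tabulate⁻ final
      (subst (λ u → isPermConcat (suc (suc k)) u ≡ true) bwt≡ (proj₂ (∧-true⁻ {isNecklaceRep w} good-w)))

  final-injective : ∀ v {i j} → final (edge v i) ≡ final (edge v j) → i ≡ j
  final-injective v = surjective⇒injective (final-onto v)

  -- The edge succeeding p in the tour: in the sorted matrix, the row of next p is the row of p rotated by one letter.
  opaque
    next : Edge → Edge
    next p = edge (target p) (proj₁ (final-onto (target p) (letter p)))

    source-next : ∀ p → source (next p) ≡ target p
    source-next p = source-edge _ _

    final-next : ∀ p → final (next p) ≡ letter p
    final-next p = proj₂ (final-onto (target p) (letter p))

  next-injective : ∀ {p q} → next p ≡ next q → p ≡ q
  next-injective {p} {q} eq = trans (sym (edgeInto-η p)) (trans (cong₂ edgeInto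
    (trans (sym (source-next p)) (trans (cong source eq) (source-next q)))
    (trans (sym (final-next p)) (trans (cong final eq) (final-next q)))) (edgeInto-η q))

  -- `row° (next p)` is `letter p` followed by the initial part of a row in block `target p`. Edges
  -- are ordered by letter and then by target; if the letters tie, a smaller target means an earlier
  -- block and so a row no larger.
  row°-next-mono : ∀ {p q} → toℕ p < toℕ q → row° (next p) ≼ row° (next q)
  row°-next-mono {p} {q} p<q = subst₂ _≼_ (sym (row°≡ (next p))) (sym (row°≡ (next q))) (compare (<⇒letter-or-target-< {p} {q} p<q))
    where
    inits : toℕ (target p) < toℕ (target q) → init (next p) ≼ init (next q)
    inits t<t = ∷ʳ-≼⁻ (init (next p)) (init (next q))
      (ℕ.suc-injective (trans (sym (length-∷ʳ (next p))) (length-∷ʳ (next q))))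
      (subst₂ _≼_ (row≡ (next p)) (row≡ (next q)) (row-mono (source-mono {next p} {next q}
        (subst₂ (λ a b → toℕ a < toℕ b) (sym (source-next p)) (sym (source-next q)) t<t))))
      where
      length-∷ʳ : ∀ q → length w ≡ suc (length (init q))
      length-∷ʳ q = trans (sym (length-row q)) (trans (cong length (row≡ q))
        (trans (List.length-++ (init q)) (ℕ.+-comm (length (init q)) 1)))
    compare : toℕ (letter p) < toℕ (letter q) ⊎ (letter p ≡ letter q × toℕ (target p) < toℕ (target q)) →
      final (next p) ∷ init (next p) ≼ final (next q) ∷ init (next q)
    compare (inj₁ a<b) = ≼-< (init (next p)) (init (next q))
      (subst₂ (λ a b → toℕ a < toℕ b) (sym (final-next p)) (sym (final-next q)) a<b)
    compare (inj₂ (a≡b , t<t)) = ≼-∷-≡ (init (next p)) (init (next q))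
      (trans (final-next p) (trans a≡b (sym (final-next q)))) (inits t<t)

  row°-next↭rotations : tabulate (row° ∘ next) ↭ rotations w
  row°-next↭rotations = ↭-trans
    (subst₂ _↭_ (List.map-tabulate next row°) (List.map-tabulate id row°) (↭.map⁺ row° (injective⇒↭ next-injective)))
    (↭-trans row°↭row rows↭rotations)

  tabulate-injective : ∀ {A : Set} {n} {f g : Fin n → A} → tabulate f ≡ tabulate g → ∀ i → f i ≡ g i
  tabulate-injective eq fzero    = List.∷-injectiveˡ eq
  tabulate-injective eq (fsuc i) = tabulate-injective (List.∷-injectiveʳ eq) i

  -- Both families list the rotations of `w` in sorted order, so they agree entry by entry. From
  -- here on rotating a row is the same as applying `next` to its index.
  row°-next : ∀ p → row° (next p) ≡ row p
  row°-next = tabulate-injective (trans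
    (sorted-unique (AllPairs.tabulate⁺-< {f = row° ∘ next} row°-next-mono) (sortLex-sorted (rotations w))
      (↭-trans row°-next↭rotations (↭-sym (sortLex-↭ (rotations w)))))
    (proj₂ sorted-rows))

  rot1-row : ∀ p → rot1 (row p) ≡ row (next p)
  rot1-row p = trans (cong rot1 (sym (row°-next p))) (rot1-row° (next p))

  iter-rot1-row : ∀ t p → iter t rot1 (row p) ≡ row (iter t next p)
  iter-rot1-row zero    p = refl
  iter-rot1-row (suc t) p = trans (cong rot1 (iter-rot1-row t p)) (rot1-row (iter t next p))

  head-row : ∀ p → head (row p) ≡ just (letter p)
  head-row p = trans (cong head (trans (sym (row°-next p)) (row°≡ (next p)))) (cong just (final-next p))

  row-root-≼ : ∀ q → row root ≼ row q
  row-root-≼ q with root-least q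
  ... | inj₁ refl = ≼-refl (row root)
  ... | inj₂ lt   = row-mono lt

  w∈rotations : w ∈ rotations w
  w∈rotations = first (length w) length-w
    where
    first : ∀ i → i ≡ suc (suc k) * suc m → w ∈ rotationsN i w
    first (suc i) _ = here refl

  row-root : row root ≡ w
  row-root with ∈.∈-tabulate⁻ {f = row} (↭.∈-resp-↭ (↭-sym rows↭rotations) w∈rotations)
  ... | q , w≡ = ≼-antisym (row root) w (subst (row root ≼_) (sym w≡) (row-root-≼ q))
    (allᵇ⁻ (lexLeq w) (rotations w) (proj₁ (∧-true⁻ good-w)) (↭.∈-resp-↭ rows↭rotations (∈.∈-tabulate⁺ {f = row} root)))

  -- Rows between two copies of the least row equal it, so a repetition would show already at the
  -- edges 0 and 1. Both leave vertex 0, and the final letters in its block are distinct.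
  row-root-once : ∀ q → row q ≡ w → q ≡ root
  row-root-once q eq with root-least q
  ... | inj₁ r≡q = sym r≡q
  ... | inj₂ r<q = contradiction (final-injective fzero (final-cong row₁≡row₀)) λ ()
    where
    second : Edge
    second = edge fzero (fsuc fzero)
    toℕ-second : toℕ second ≡ 1
    toℕ-second = trans (toℕ-edge fzero (fsuc fzero)) (cong (_+ 1) (ℕ.*-zeroʳ (suc (suc k))))
    row-second-≼ : row second ≼ row q
    row-second-≼ with ℕ.m≤n⇒m<n∨m≡n (subst (_≤ toℕ q) (trans (cong suc toℕ-root) (sym toℕ-second)) r<q)
    ... | inj₁ lt = row-mono lt
    ... | inj₂ s≡q with Fin.toℕ-injective s≡q
    ... | refl = ≼-refl (row second)
    row₁≡row₀ : row second ≡ row root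
    row₁≡row₀ = ≼-antisym (row second) (row root)
      (subst (row second ≼_) (trans eq (sym row-root)) row-second-≼) (row-root-≼ second)
    final-cong : ∀ {p q} → row p ≡ row q → final p ≡ final q
    final-cong {p} {q} e = List.∷ʳ-injectiveʳ (init p) (init q) (trans (sym (row≡ p)) (trans e (row≡ q)))

  -- Completing the `t` rotations behind `row p` to a full turn takes both rows to `w`, hence both
  -- indices to `root`. As `next` is injective, the indices were equal from the start.
  row-injective : ∀ {p q} → row p ≡ row q → p ≡ q
  row-injective {p} {q} eq with row-rotation p
  ... | t , t<l , row-p≡ = iter-injective next-injective s
    (trans (row-root-once _ (trans (sym (iter-rot1-row s p)) back))
           (sym (row-root-once _ (trans (sym (iter-rot1-row s q)) (trans (cong (iter s rot1) (sym eq)) back)))))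
    where
    open ≡-Reasoning
    s : ℕ
    s = length w ∸ t
    back : iter s rot1 (row p) ≡ w
    back = begin
      iter s rot1 (row p)            ≡⟨ cong (iter s rot1) row-p≡ ⟩
      iter s rot1 (iter t rot1 w)    ≡⟨ iter-+ s t rot1 w ⟨
      iter (s + t) rot1 w            ≡⟨ cong (λ i → iter i rot1 w) (ℕ.m∸n+n≡m (ℕ.<⇒≤ t<l)) ⟩
      iter (length w) rot1 w         ≡⟨ iter-length-rot1 w ⟩
      w                              ∎

  orbit : ℕ → Edge → List Edge
  orbit zero    p = []
  orbit (suc i) p = p ∷ orbit i (next p)

  length-orbit : ∀ i p → length (orbit i p) ≡ i
  length-orbit zero    p = refl
  length-orbit (suc i) p = cong suc (length-orbit i (next p))

  orbit-walk : ∀ i p → Walk (source p) (orbit i p) (source (iter i next p))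
  orbit-walk zero    p = nil
  orbit-walk (suc i) p = step refl (subst₂ (λ v q → Walk v (orbit i (next p)) (source q)) (source-next p)
    (iter-shift i next p) (orbit-walk i (next p)))

  rows-orbit : ∀ i p → map row (orbit i p) ≡ rotationsN i (row p)
  rows-orbit zero    p = refl
  rows-orbit (suc i) p = cong (row p ∷_) (trans (rows-orbit i (next p)) (cong (rotationsN i) (sym (rot1-row p))))

  es : List Edge
  es = orbit N root

  rows-es : map row es ≡ rotations w
  rows-es = trans (rows-orbit N root) (cong₂ rotationsN (sym length-w) row-root)

  letters : map letter es ≡ w
  letters = List.map-injective Maybe.just-injective (begin
    map just (map letter es)  ≡⟨ List.map-∘ es ⟨
    map (just ∘ letter) es    ≡⟨ List.map-cong head-row es ⟨
    map (head ∘ row) es       ≡⟨ List.map-∘ es ⟩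
    map head (map row es)     ≡⟨ cong (map head) rows-es ⟩
    map head (rotations w)    ≡⟨ map-head-rotations w ⟩
    map just w                ∎)
    where open ≡-Reasoning

  -- Every row is a rotation of `w`, hence the row of some edge in the orbit of `root`, and rows
  -- determine edges. So the orbit of length `N` meets every edge.
  tour : Tour es
  tour = record
    { closed = subst₂ (λ v q → Walk v es q) (source-edge fzero fzero) (trans (cong source returns) (source-edge fzero fzero))
                 (orbit-walk N root)
    ; covers = covering⇒↭-allFin (length-orbit N root) visited
    ; starts = _ , refl
    }
    where
    -- `N` rotations restore `w`, and only `root` has `w` as its row.
    returns : iter N next root ≡ root
    returns = row-root-once _ (trans (sym (iter-rot1-row N root))
      (trans (cong₂ (λ i u → iter i rot1 u) (sym length-w) row-root) (iter-length-rot1 w)))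
    visited : ∀ q → q ∈ es
    visited q with ∈.∈-map⁻ row (subst (row q ∈_) (sym rows-es) (↭.∈-resp-↭ rows↭rotations (∈.∈-tabulate⁺ {f = row} q)))
    ... | e , e∈ , eq = subst (_∈ es) (sym (row-injective eq)) e∈

-- Comparing the two counts

toList-injective : ∀ {A : Set} {n} {u v : Vec A n} → toList u ≡ toList v → u ≡ v
toList-injective {u = u} {v} eq = trans (sym (Vec.cast-is-id refl u)) (Vec.toList-injective refl u v eq)

Unique-allWords : ∀ k N → Unique (allWords k N)
Unique-allWords k N = Unique.map⁺ toList-injective (Unique-allVecs k N)

∈-allWords⁺ : ∀ {k N} (w : Word k) → length w ≡ N → w ∈ allWords k N
∈-allWords⁺ {k} w refl = subst (_∈ allWords k (length w)) (Vec.toList∘fromList w) (∈.∈-map⁺ toList (∈-allVecs k (Vec.fromList w)))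

∈-allWords⁻ : ∀ {k N} {w : Word k} → w ∈ allWords k N → length w ≡ N
∈-allWords⁻ p with ∈.∈-map⁻ toList p
... | v , _ , refl = Vec.length-toList v

module _ (k m : ℕ) where
  open EulerTours (suc k) m
  open Words (suc k) m

  goodWords : List (Word (suc (suc k)))
  goodWords = filterᵇ good (allWords (suc (suc k)) N)

  Unique-goodWords : Unique goodWords
  Unique-goodWords = Unique-filterᵇ good (Unique-allWords (suc (suc k)) N)

  -- The tour is determined from either side: by the orders, replayed forwards from the root, and by
  -- the letters, read backwards from it. This makes the relation one-to-one.
  Corresponds : Word (suc (suc k)) → Orders → Set
  Corresponds w L = ∃[ es ] Tour es × map letter es ≡ w × (∀ u → exits u es ≡ lookup L u)

  Corresponds-injectiveˡ : ∀ {w w′ L} → Corresponds w L → Corresponds w′ L → w ≡ w′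
  Corresponds-injectiveˡ (es , t , refl , ex) (es′ , t′ , refl , ex′) =
    cong (map letter) (walk-determined (Tour.closed t) (Tour.closed t′) (λ u → trans (ex u) (sym (ex′ u))))

  Corresponds-injectiveʳ : ∀ {w L L′} → Corresponds w L → Corresponds w L′ → L ≡ L′
  Corresponds-injectiveʳ (es , t , eq , ex) (es′ , t′ , eq′ , ex′)
    with letters-determine-walk (Tour.closed t) (Tour.closed t′) (trans eq (sym eq′))
  ... | refl = lookup-ext (λ u → trans (sym (ex u)) (ex′ u))

  word⇒orders : ∀ {w} → w ∈ goodWords → ∃[ L ] L ∈ families × Corresponds w L
  word⇒orders {w} w∈ with ∈-filterᵇ⁻ good {xs = allWords (suc (suc k)) N} w∈
  ... | w∈all , good-w = Vec.tabulate (λ u → exits u es) , tour⇒family tour , es , tour , letters ,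
      λ u → sym (Vec.lookup∘tabulate (λ u → exits u es) u)
    where open WordTour k m w (∈-allWords⁻ w∈all) good-w

  length-letters : ∀ {es} → Tour es → length (map letter es) ≡ N
  length-letters {es} tour = trans (List.length-map letter es) (trans (↭.↭-length (Tour.covers tour)) (length-allFin N))

  tour-∈-goodWords : ∀ {es} → Tour es → map letter es ∈ goodWords
  tour-∈-goodWords {es} tour = ∈-filterᵇ⁺ good {map letter es} {allWords (suc (suc k)) N}
    (∈-allWords⁺ (map letter es) (length-letters tour)) (TourWord.tour⇒good tour)

  orders⇒word : ∀ {L} → L ∈ families → ∃[ w ] w ∈ goodWords × Corresponds w L
  orders⇒word L∈ =
    let es , tour , ex = family⇒tour L∈ in map letter es , tour-∈-goodWords tour , es , tour , refl , ex

  count-goodWords : length goodWords ≡ length families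
  count-goodWords = ℕ.≤-antisym
    (length≤-by-relation Corresponds Unique-goodWords word⇒orders
      (λ {w} {w′} {L} → Corresponds-injectiveˡ {w} {w′} {L}))
    (length≤-by-relation (λ L w → Corresponds w L) Unique-families orders⇒word
      (λ {L} {L′} {w} → Corresponds-injectiveʳ {w} {L} {L′}))

theorem12 : (k n : ℕ) → 2 ≤ k → 1 ≤ n →
    DBW k (k * n) ≡ ((k ∸ 1) !) ^ n * κDB k n
theorem12 (suc (suc k)) (suc m) (s≤s (s≤s z≤n)) (s≤s z≤n) = trans (count-goodWords k m) (EulerTours.length-families (suc k) m)
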